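{- Let $b$ be a positive integer. For $0<t<1$ put $q=\frac{1-t}{1+t}$ and \[ f_b(t):=2\sum_{n=0}^\infty (-1)^n q^{n^2+bn}. \] Let $f_b(t)\sim\sum_{n=0}^\infty a_n t^n$ be the asymptotic expansion of $f_b$ as $t\to 0^+$ (see context). If $b\equiv 1,2\pmod 4$, then $a_n>0$ for all sufficiently large $n$; if $b\equiv 0,3\pmod 4$, then $a_n<0$ for all sufficiently large $n$. In particular, for every positive integer $b$ the coefficients $a_n$ all have the same sign for sufficiently large $n$.
   Context: The function $f_b(t)$ (a partial theta function) admits an asymptotic power series expansion $f_b(t)\sim\sum_{n\ge0}a_nt^n$ as $t\to0^+$ with real coefficients $a_n$ depending on $b$. This means that for every $N\ge 0$ one has $f_b(t)-\sum_{n=0}^{N}a_nt^n=O(t^{N+1})$ as $t\to 0^+$; the existence of such an expansion is a known result of Berndt and Kim, and the coefficients $a_n$ are uniquely determined by $f_b$. -}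

module Defs where

open import Algebra.Apartness.Bundles using (HeytingField; HeytingCommutativeRing)
open import Algebra.Bundles using (CommutativeRing; Semiring)
import Algebra.Definitions.RawSemiring as RawSemiringOps
open import Data.Empty using (⊥-elim)
open import Data.Fin.Base using (toℕ)
open import Data.Nat.Base as ℕ using (ℕ; zero; suc)
import Data.Nat.Properties as ℕ
open import Data.Product.Base using (∃-syntax; _×_; _,_; proj₁; proj₂)
open import Data.Sum.Base using (_⊎_; inj₁; inj₂)
open import Function.Base using (_∘_)
open import Level using (Level; _⊔_) renaming (suc to lsuc)
open import Relation.Binary.Core using (Rel)
open import Relation.Binary.PropositionalEquality.Core as ≡ using (_≡_)
open import Relation.Binary.Structures using (IsStrictPartialOrder)
open import Relation.Nullary.Negation using (¬_)

-- The real numbers, given axiomatically as a Cauchy-complete Archimedean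
-- ordered field.  Classically these axioms determine ℝ up to unique
-- isomorphism.  They are phrased so that they also hold constructively: the
-- order is not assumed decidable, and inverses exist for elements apart from 0.

record RealField c ℓ₁ ℓ₂ : Set (lsuc (c ⊔ ℓ₁ ⊔ ℓ₂)) where
  infix 4 _<_ _≤_ ∣_-_∣<_ ∣_-_∣≤_ _ConvergesTo_

  field
    heytingField : HeytingField c ℓ₁ ℓ₂

  open HeytingField heytingField public

  commutativeRing : CommutativeRing c ℓ₁
  commutativeRing = HeytingCommutativeRing.commutativeRing heytingCommutativeRing

  open CommutativeRing commutativeRing public using (ring; semiring)

  -- The library's n × x is n-fold addition; it is renamed because _×_ denotes
  -- the product of types here.
  open RawSemiringOps (Semiring.rawSemiring semiring) public
    using (_^_; sum) renaming (_×_ to _·_)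

  field
    _<_                  : Rel Carrier ℓ₂
    isStrictPartialOrder : IsStrictPartialOrder _≈_ _<_
    #⇒<⊎>                : ∀ {x y} → x # y → x < y ⊎ y < x
    <⇒#                  : ∀ {x y} → x < y → x # y
    +-monoˡ-<            : ∀ {x y} z → x < y → x + z < y + z
    *-pos                : ∀ {x y} → 0# < x → 0# < y → 0# < x * y
    archimedean          : ∀ x → ∃[ n ] x < n · 1#

  _≤_ : Rel Carrier ℓ₂
  x ≤ y = ¬ y < x

  -- Bounds on the absolute value of a difference, as two one-sided bounds.
  ∣_-_∣<_ : Carrier → Carrier → Carrier → Set ℓ₂
  ∣ x - y ∣< ε = (x - y < ε) × (y - x < ε)

  ∣_-_∣≤_ : Carrier → Carrier → Carrier → Set ℓ₂
  ∣ x - y ∣≤ ε = (x - y ≤ ε) × (y - x ≤ ε)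

  Cauchy : (ℕ → Carrier) → Set (c ⊔ ℓ₂)
  Cauchy s = ∀ ε → 0# < ε →
    ∃[ N ] (∀ m n → N ℕ.≤ m → N ℕ.≤ n → ∣ s m - s n ∣< ε)

  _ConvergesTo_ : (ℕ → Carrier) → Carrier → Set (c ⊔ ℓ₂)
  s ConvergesTo l = ∀ ε → 0# < ε → ∃[ N ] (∀ n → N ℕ.≤ n → ∣ s n - l ∣< ε)

  field
    complete : ∀ s → Cauchy s → ∃[ l ] s ConvergesTo l

module Real {c ℓ₁ ℓ₂} (R : RealField c ℓ₁ ℓ₂) where

  infix 4 _∼_

  open RealField R
  open IsStrictPartialOrder isStrictPartialOrder
    using (<-respʳ-≈; <-respˡ-≈)
    renaming (irrefl to <-irrefl; trans to <-trans; asym to <-asym)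
  open import Algebra.Apartness.Properties.HeytingCommutativeRing heytingCommutativeRing
    using (x-0≈x; 1#0; invertibleˡ⇒#)
  open import Algebra.Properties.Ring ring
    using (-0#≈0#; -‿involutive; -‿anti-homo-+; -1*x≈-x; x[y-z]≈xy-xz)
  open import Algebra.Properties.Semiring.Exp semiring using (^-homo-*; ^-congʳ)
  open import Algebra.Properties.Semiring.Sum semiring using (sum-cong-≋; *-distribˡ-sum)
  open import Relation.Binary.Reasoning.Setoid setoid

  ∑< : ℕ → (ℕ → Carrier) → Carrier
  ∑< n u = sum {n} (u ∘ toℕ)

  ∑∞ : (u : ℕ → Carrier) → Cauchy (λ n → ∑< n u) → Carrier
  ∑∞ u cauchy = proj₁ (complete (λ n → ∑< n u) cauchy)

  inv : ∀ x → 0# < x → Carrier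
  inv x 0<x = proj₁ (#⇒invertible (#-sym (<⇒# 0<x)))

  inv-inverseˡ : ∀ x 0<x → inv x 0<x * x ≈ 1#
  inv-inverseˡ x 0<x =
    trans (*-congˡ (sym (x-0≈x x))) (proj₁ (proj₂ (#⇒invertible (#-sym (<⇒# 0<x)))))

  inv-inverseʳ : ∀ x 0<x → x * inv x 0<x ≈ 1#
  inv-inverseʳ x 0<x = trans (*-comm _ _) (inv-inverseˡ x 0<x)

  x+y-y : ∀ x y → (x + y) + - y ≈ x
  x+y-y x y = trans (+-assoc _ _ _) (trans (+-congˡ (-‿inverseʳ y)) (+-identityʳ x))

  x-y+y : ∀ x y → (x - y) + y ≈ x
  x-y+y x y = trans (+-assoc _ _ _) (trans (+-congˡ (-‿inverseˡ y)) (+-identityʳ x))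

  -[x-y] : ∀ x y → - (x - y) ≈ y - x
  -[x-y] x y = trans (-‿anti-homo-+ x (- y)) (+-congʳ (-‿involutive y))

  <-resp : ∀ {x x′ y y′} → x ≈ x′ → y ≈ y′ → x < y → x′ < y′
  <-resp x≈ y≈ = <-respʳ-≈ y≈ ∘ <-respˡ-≈ x≈

  ≤-resp : ∀ {x x′ y y′} → x ≈ x′ → y ≈ y′ → x ≤ y → x′ ≤ y′
  ≤-resp x≈ y≈ x≤y = x≤y ∘ <-resp (sym y≈) (sym x≈)

  <-cotrans : ∀ {x y} → x < y → ∀ z → x < z ⊎ z < y
  <-cotrans x<y z with #-cotrans (<⇒# x<y) z
  ... | inj₁ x#z with #⇒<⊎> x#z
  ...   | inj₁ x<z = inj₁ x<z
  ...   | inj₂ z<x = inj₂ (<-trans z<x x<y)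
  <-cotrans x<y z | inj₂ z#y with #⇒<⊎> z#y
  ...   | inj₁ z<y = inj₂ z<y
  ...   | inj₂ y<z = inj₁ (<-trans x<y y<z)

  <⇒≤ : ∀ {x y} → x < y → x ≤ y
  <⇒≤ = <-asym

  ≤-refl : ∀ {x} → x ≤ x
  ≤-refl = <-irrefl refl

  ≤-trans : ∀ {x y z} → x ≤ y → y ≤ z → x ≤ z
  ≤-trans {y = y} x≤y y≤z z<x with <-cotrans z<x y
  ... | inj₁ z<y = y≤z z<y
  ... | inj₂ y<x = x≤y y<x

  ≤-<-trans : ∀ {x y z} → x ≤ y → y < z → x < z
  ≤-<-trans {x} x≤y y<z with <-cotrans y<z x
  ... | inj₁ y<x = ⊥-elim (x≤y y<x)
  ... | inj₂ x<z = x<z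

  <-≤-trans : ∀ {x y z} → x < y → y ≤ z → x < z
  <-≤-trans {z = z} x<y y≤z with <-cotrans x<y z
  ... | inj₁ x<z = x<z
  ... | inj₂ z<y = ⊥-elim (y≤z z<y)

  +-monoʳ-< : ∀ {x y} z → x < y → z + x < z + y
  +-monoʳ-< z = <-resp (+-comm _ _) (+-comm _ _) ∘ +-monoˡ-< z

  +-monoʳ-≤ : ∀ {x y} z → x ≤ y → z + x ≤ z + y
  +-monoʳ-≤ {x} {y} z x≤y lt = x≤y (<-resp (cancel y) (cancel x) (+-monoˡ-< (- z) lt))
    where
    cancel : ∀ w → (z + w) + - z ≈ w
    cancel w = trans (+-congʳ (+-comm z w)) (x+y-y w z)

  x<y⇒0<y-x : ∀ {x y} → x < y → 0# < y - x
  x<y⇒0<y-x {x} = <-resp (-‿inverseʳ x) refl ∘ +-monoˡ-< (- x)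

  0<y-x⇒x<y : ∀ {x y} → 0# < y - x → x < y
  0<y-x⇒x<y {x} {y} = <-resp (+-identityˡ x) (x-y+y y x) ∘ +-monoˡ-< x

  neg-anti-< : ∀ {x y} → x < y → - y < - x
  neg-anti-< {x} {y} x<y = 0<y-x⇒x<y (<-respʳ-≈ eq (x<y⇒0<y-x x<y))
    where
    eq : y - x ≈ - x - - y
    eq = trans (+-comm _ _) (+-congˡ (sym (-‿involutive y)))

  neg-anti-≤ : ∀ {x y} → x ≤ y → - y ≤ - x
  neg-anti-≤ x≤y lt = x≤y (<-resp (-‿involutive _) (-‿involutive _) (neg-anti-< lt))

  *-monoˡ-< : ∀ {x y z} → 0# < z → x < y → z * x < z * y
  *-monoˡ-< {x} {y} {z} 0<z x<y =
    0<y-x⇒x<y (<-respʳ-≈ (x[y-z]≈xy-xz z y x) (*-pos 0<z (x<y⇒0<y-x x<y)))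

  0<1 : 0# < 1#
  0<1 with #⇒<⊎> 1#0
  ... | inj₂ 0<1 = 0<1
  ... | inj₁ 1<0 = <-respʳ-≈ eq (*-pos 0<-1 0<-1)
    where
    0<-1 : 0# < - 1#
    0<-1 = <-respˡ-≈ -0#≈0# (neg-anti-< 1<0)
    eq : - 1# * - 1# ≈ 1#
    eq = trans (-1*x≈-x (- 1#)) (-‿involutive 1#)

  inv-pos : ∀ x 0<x → 0# < inv x 0<x
  inv-pos x 0<x with #⇒<⊎> (invertibleˡ⇒# {inv x 0<x} {0#}
                      (x , trans (*-congˡ (x-0≈x _)) (inv-inverseʳ x 0<x)))
  ... | inj₂ 0<i = 0<i
  ... | inj₁ i<0 = ⊥-elim (<-asym 0<1
          (<-resp (inv-inverseʳ x 0<x) (zeroʳ x) (*-monoˡ-< 0<x i<0)))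

  inv-cancel : ∀ z 0<z x → inv z 0<z * (z * x) ≈ x
  inv-cancel z 0<z x =
    trans (sym (*-assoc _ _ _)) (trans (*-congʳ (inv-inverseˡ z 0<z)) (*-identityˡ x))

  *-cancelˡ-< : ∀ {x y z} → 0# < z → z * x < z * y → x < y
  *-cancelˡ-< {x} {y} {z} 0<z =
    <-resp (inv-cancel z 0<z x) (inv-cancel z 0<z y) ∘ *-monoˡ-< (inv-pos z 0<z)

  *-monoˡ-≤ : ∀ {x y z} → 0# < z → x ≤ y → z * x ≤ z * y
  *-monoˡ-≤ 0<z x≤y = x≤y ∘ *-cancelˡ-< 0<z

  0≤n·1 : ∀ n → 0# ≤ n · 1#
  0≤n·1 zero    = ≤-refl
  0≤n·1 (suc n) = ≤-trans (0≤n·1 n)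
    (≤-resp (+-identityˡ _) refl (<⇒≤ (+-monoˡ-< (n · 1#) 0<1)))

  ^-pos : ∀ {q} → 0# < q → ∀ n → 0# < q ^ n
  ^-pos 0<q zero    = 0<1
  ^-pos 0<q (suc n) = *-pos 0<q (^-pos 0<q n)

  ∣-∣<-sym : ∀ {x y ε} → ∣ x - y ∣< ε → ∣ y - x ∣< ε
  ∣-∣<-sym (p , q) = q , p

  module _ {q} (0<q : 0# < q) (q<1 : q < 1#) where

    ^-≤-1 : ∀ n → q ^ n ≤ 1#
    ^-≤-1 zero    = ≤-refl
    ^-≤-1 (suc n) = ≤-trans (*-monoˡ-≤ 0<q (^-≤-1 n))
      (≤-resp (sym (*-identityʳ q)) refl (<⇒≤ q<1))

    ^-antitone : ∀ {m n} → m ℕ.≤ n → q ^ n ≤ q ^ m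
    ^-antitone {m} {n} m≤n = ≤-resp eq (*-identityʳ _) (*-monoˡ-≤ (^-pos 0<q m) (^-≤-1 (n ℕ.∸ m)))
      where
      eq : q ^ m * q ^ (n ℕ.∸ m) ≈ q ^ n
      eq = trans (sym (^-homo-* q m (n ℕ.∸ m))) (^-congʳ q (ℕ.m+[n∸m]≡n m≤n))

    private
      h : Carrier
      h = 1# - q

      0<h : 0# < h
      0<h = x<y⇒0<y-x q<1

      q+h≈1 : q + h ≈ 1#
      q+h≈1 = trans (+-comm q h) (x-y+y 1# q)

    0≤n·1*h : ∀ n → 0# ≤ n · 1# * h
    0≤n·1*h n = ≤-resp (zeroʳ h) (*-comm h _) (*-monoˡ-≤ 0<h (0≤n·1 n))

    1≤1+nh : ∀ n → 1# ≤ 1# + n · 1# * h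
    1≤1+nh n = ≤-resp (+-identityʳ 1#) refl (+-monoʳ-≤ 1# (0≤n·1*h n))

    bernoulli : ∀ n → q ^ n * (1# + n · 1# * h) ≤ 1#
    bernoulli zero = ≤-resp (sym eq) refl ≤-refl
      where
      eq : 1# * (1# + 0# * h) ≈ 1#
      eq = trans (*-identityˡ _) (trans (+-congˡ (zeroˡ h)) (+-identityʳ 1#))
    bernoulli (suc n) =
      ≤-trans (≤-resp eq₁ refl (*-monoˡ-≤ (^-pos 0<q n) step)) (bernoulli n)
      where
      x = n · 1#
      b = 1# + x * h

      eq₁ : q ^ n * (q * (1# + (1# + x) * h)) ≈ q ^ suc n * (1# + (1# + x) * h)
      eq₁ = trans (sym (*-assoc _ _ _)) (*-congʳ (*-comm _ _))

      eq₂ : q * b + h * q ≈ q * (1# + (1# + x) * h)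
      eq₂ = begin
        q * b + h * q                ≈⟨ +-congˡ (*-comm h q) ⟩
        q * b + q * h                ≈⟨ distribˡ q b h ⟨
        q * (b + h)                  ≈⟨ *-congˡ (+-assoc _ _ _) ⟩
        q * (1# + (x * h + h))       ≈⟨ *-congˡ (+-congˡ (+-comm _ _)) ⟩
        q * (1# + (h + x * h))       ≈⟨ *-congˡ (+-congˡ (+-congʳ (*-identityˡ h))) ⟨
        q * (1# + (1# * h + x * h))  ≈⟨ *-congˡ (+-congˡ (distribʳ h 1# x)) ⟨
        q * (1# + (1# + x) * h)      ∎

      eq₃ : q * b + h * b ≈ b
      eq₃ = trans (sym (distribʳ b q h)) (trans (*-congʳ q+h≈1) (*-identityˡ b))

      step : q * (1# + (1# + x) * h) ≤ b
      step = ≤-resp eq₂ eq₃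
        (+-monoʳ-≤ (q * b) (*-monoˡ-≤ 0<h (≤-trans (<⇒≤ q<1) (1≤1+nh n))))

    ^-small : ∀ ε → 0# < ε → ∃[ N ] q ^ N < ε
    ^-small ε 0<ε = N , *-cancelˡ-< 0<b (≤-<-trans (≤-resp (*-comm _ _) refl (bernoulli N)) 1<bε)
      where
      0<hε = *-pos 0<h 0<ε
      arch = archimedean (inv (h * ε) 0<hε)
      N = proj₁ arch
      b = 1# + N · 1# * h

      0<b : 0# < b
      0<b = <-≤-trans 0<1 (1≤1+nh N)

      1<Nhε : 1# < N · 1# * h * ε
      1<Nhε = <-resp (inv-inverseʳ _ 0<hε) (trans (*-comm _ _) (sym (*-assoc _ _ _)))
        (*-monoˡ-< 0<hε (proj₂ arch))

      1<bε : 1# < b * ε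
      1<bε = <-trans 1<Nhε
        (<-resp (+-identityˡ _)
                (trans (+-congʳ (sym (*-identityˡ ε))) (sym (distribʳ ε 1# _)))
                (+-monoˡ-< _ 0<ε))

  alternating : (ℕ → Carrier) → ℕ → Carrier
  alternating v n = (- 1#) ^ n * v n

  ∑<-split : ∀ u m k → ∑< (m ℕ.+ k) u - ∑< m u ≈ ∑< k (u ∘ (m ℕ.+_))
  ∑<-split u zero    k = x-0≈x _
  ∑<-split u (suc m) k = trans eq (∑<-split (u ∘ suc) m k)
    where
    eq : ∀ {a x y} → (a + x) - (a + y) ≈ x - y
    eq {a} {x} {y} = begin
      (a + x) - (a + y)        ≈⟨ +-cong (+-comm a x) (-‿anti-homo-+ a y) ⟩
      (x + a) + (- y + - a)    ≈⟨ +-congˡ (+-comm _ _) ⟩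
      (x + a) + (- a + - y)    ≈⟨ +-assoc _ _ _ ⟨
      ((x + a) + - a) + - y    ≈⟨ +-congʳ (x+y-y x a) ⟩
      x - y                    ∎

  alternating-shift : ∀ v m k →
    ∑< k (alternating v ∘ (m ℕ.+_)) ≈ (- 1#) ^ m * ∑< k (alternating (v ∘ (m ℕ.+_)))
  alternating-shift v m k =
    trans (sum-cong-≋ {k} λ i → trans (*-congʳ (^-homo-* (- 1#) m (toℕ i))) (*-assoc _ _ _))
          (sym (*-distribˡ-sum {k} _ _))

  alternating-bound : ∀ v → (∀ n → 0# ≤ v n) → (∀ n → v (suc n) ≤ v n) → ∀ k →
    (0# ≤ ∑< k (alternating v)) × (∑< k (alternating v) ≤ v 0)
  alternating-bound v 0≤v v↓ zero    = ≤-refl , 0≤v 0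
  alternating-bound v 0≤v v↓ (suc k) =
    ≤-resp (-‿inverseʳ (v 0)) (sym eq) (+-monoʳ-≤ (v 0) (neg-anti-≤ (≤-trans w≤ (v↓ 0)))) ,
    ≤-resp (sym eq) (x-0≈x (v 0)) (+-monoʳ-≤ (v 0) (neg-anti-≤ 0≤w))
    where
    w = ∑< k (alternating (v ∘ suc))
    ih = alternating-bound (v ∘ suc) (0≤v ∘ suc) (v↓ ∘ suc) k
    0≤w = proj₁ ih
    w≤  = proj₂ ih

    eq : ∑< (suc k) (alternating v) ≈ v 0 - w
    eq = +-cong (*-identityˡ (v 0)) (trans (alternating-shift v 1 k)
           (trans (*-congʳ (*-identityʳ (- 1#))) (-1*x≈-x w)))

  sign-bound : ∀ m {x ε} → x < ε → - x < ε →
    ((- 1#) ^ m * x < ε) × (- ((- 1#) ^ m * x) < ε)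
  sign-bound zero    {x} p p′ =
    <-respˡ-≈ (sym (*-identityˡ x)) p , <-respˡ-≈ (-‿cong (sym (*-identityˡ x))) p′
  sign-bound (suc m) {x} p p′ with sign-bound m p p′
  ... | r , r′ = <-respˡ-≈ (sym eq) r′ ,
                 <-respˡ-≈ (trans (sym (-‿involutive _)) (-‿cong (sym eq))) r
    where
    eq : (- 1#) ^ suc m * x ≈ - ((- 1#) ^ m * x)
    eq = trans (*-assoc _ _ _) (-1*x≈-x _)

  alternating-cauchy : ∀ v → (∀ n → 0# ≤ v n) → (∀ n → v (suc n) ≤ v n) →
    (∀ ε → 0# < ε → ∃[ N ] (∀ n → N ℕ.≤ n → v n < ε)) →
    Cauchy (λ n → ∑< n (alternating v))
  alternating-cauchy v 0≤v v↓ v→0 ε 0<ε = N , close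
    where
    N = proj₁ (v→0 ε 0<ε)
    S = λ n → ∑< n (alternating v)

    ordered : ∀ m k → N ℕ.≤ m → ∣ S (m ℕ.+ k) - S m ∣< ε
    ordered m k N≤m =
      <-respˡ-≈ (sym eq) (proj₁ bounds) ,
      <-respˡ-≈ (trans (-‿cong (sym eq)) (-[x-y] _ _)) (proj₂ bounds)
      where
      v′ = v ∘ (m ℕ.+_)
      w  = ∑< k (alternating v′)

      v′↓ : ∀ n → v′ (suc n) ≤ v′ n
      v′↓ n = ≡.subst (λ j → v j ≤ v (m ℕ.+ n)) (≡.sym (ℕ.+-suc m n)) (v↓ (m ℕ.+ n))

      eq : S (m ℕ.+ k) - S m ≈ (- 1#) ^ m * w
      eq = trans (∑<-split (alternating v) m k) (alternating-shift v m k)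

      w-bound = alternating-bound v′ (λ n → 0≤v (m ℕ.+ n)) v′↓ k

      bounds = sign-bound m
        (≤-<-trans (proj₂ w-bound) (proj₂ (v→0 ε 0<ε) (m ℕ.+ 0) (ℕ.≤-trans N≤m (ℕ.m≤m+n m 0))))
        (≤-<-trans (≤-resp refl -0#≈0# (neg-anti-≤ (proj₁ w-bound))) 0<ε)

    close : ∀ m n → N ℕ.≤ m → N ℕ.≤ n → ∣ S m - S n ∣< ε
    close m n N≤m N≤n with ℕ.≤-total m n
    ... | inj₁ m≤n = ∣-∣<-sym (≡.subst (λ j → ∣ S j - S m ∣< ε) (ℕ.m+[n∸m]≡n m≤n) (ordered m _ N≤m))
    ... | inj₂ n≤m = ≡.subst (λ j → ∣ S j - S n ∣< ε) (ℕ.m+[n∸m]≡n n≤m) (ordered n _ N≤n)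

  thetaTerm : ℕ → Carrier → ℕ → Carrier
  thetaTerm b q n = (- 1#) ^ n * q ^ (n ℕ.* n ℕ.+ b ℕ.* n)

  thetaTerm-cauchy : ∀ b {q} → 0# < q → q < 1# → Cauchy (λ n → ∑< n (thetaTerm b q))
  thetaTerm-cauchy b {q} 0<q q<1 = alternating-cauchy (λ n → q ^ e n)
    (λ n → <⇒≤ (^-pos 0<q (e n)))
    (λ n → ^-antitone 0<q q<1 (e-mono n))
    (λ ε 0<ε → let N , q^N<ε = ^-small 0<q q<1 ε 0<ε in
      N , λ n N≤n → ≤-<-trans (^-antitone 0<q q<1 (ℕ.≤-trans N≤n (n≤e n))) q^N<ε)
    where
    e : ℕ → ℕ
    e n = n ℕ.* n ℕ.+ b ℕ.* n

    e-mono : ∀ n → e n ℕ.≤ e (suc n)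
    e-mono n = ℕ.+-mono-≤ (ℕ.*-mono-≤ (ℕ.n≤1+n n) (ℕ.n≤1+n n)) (ℕ.*-monoʳ-≤ b (ℕ.n≤1+n n))

    n≤e : ∀ n → n ℕ.≤ e n
    n≤e zero    = ℕ.z≤n
    n≤e (suc n) = ℕ.≤-trans (ℕ.m≤m*n (suc n) (suc n)) (ℕ.m≤m+n _ _)

  0<1+t : ∀ {t} → 0# < t → 0# < 1# + t
  0<1+t 0<t = <-trans 0<1 (<-respˡ-≈ (+-identityʳ 1#) (+-monoʳ-< 1# 0<t))

  nome : ∀ t → 0# < t → Carrier
  nome t 0<t = (1# - t) * inv (1# + t) (0<1+t 0<t)

  0<nome : ∀ t 0<t → t < 1# → 0# < nome t 0<t
  0<nome t 0<t t<1 = *-pos (x<y⇒0<y-x t<1) (inv-pos _ _)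

  nome<1 : ∀ t 0<t → nome t 0<t < 1#
  nome<1 t 0<t = <-resp (*-comm _ _) (inv-inverseˡ _ _)
    (*-monoˡ-< (inv-pos _ (0<1+t 0<t)) (+-monoʳ-< 1# (<-trans -t<0 0<t)))
    where
    -t<0 : - t < 0#
    -t<0 = <-respʳ-≈ -0#≈0# (neg-anti-< 0<t)

  -- f b is the function f_b on the open interval (0,1).
  f : ℕ → ∀ t → 0# < t → t < 1# → Carrier
  f b t 0<t t<1 =
    (1# + 1#) * ∑∞ (thetaTerm b q) (thetaTerm-cauchy b (0<nome t 0<t t<1) (nome<1 t 0<t))
    where
    q = nome t 0<t

  -- g t ~ ∑ aₙ tⁿ as t → 0⁺, for g defined on (0,1): for every N the error of the
  -- truncation after the term a_N t^N is O(t^(N+1)).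
  _∼_ : (∀ t → 0# < t → t < 1# → Carrier) → (ℕ → Carrier) → Set (c ⊔ ℓ₂)
  g ∼ a = ∀ N → ∃[ C ] ∃[ δ ] (0# < δ) ×
    (∀ t (0<t : 0# < t) (t<1 : t < 1#) → t < δ →
      ∣ g t 0<t t<1 - ∑< (suc N) (λ n → a n * t ^ n) ∣≤ (C * t ^ suc N))

  EventuallyPositive : (ℕ → Carrier) → Set ℓ₂
  EventuallyPositive a = ∃[ N ] (∀ n → N ℕ.≤ n → 0# < a n)

  EventuallyNegative : (ℕ → Carrier) → Set ℓ₂
  EventuallyNegative a = ∃[ N ] (∀ n → N ℕ.≤ n → a n < 0#)

{-# OPTIONS --safe #-}
module Submission where

-- Write ∇ v n = v n - v (n + 1) and g n = q^(n² + b n).  Summation by parts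
-- (Euler's transformation) turns f_b = 2 ∑ (-1)ⁿ g n into ∑_{k<M} 2⁻ᵏ ∇ᵏ g 0 plus
-- an alternating sum of ∇ᴹ g.  The products uₖ n = g n ∏_{i<k} (1 - q^(2n+b+1+2i))
-- satisfy ∇ uₖ n = uₖ₊₁ n - (1 - q²ᵏ) uₖ₋₁ (n + 1), and this makes the remainder
-- O(t^(M/2 - 1)).  Hence a_n = L [w_n (x² + b x)], where w_n (e) = [tⁿ] qᵉ is a
-- polynomial in e and L is the functional L [p] = ∑ 2⁻ᵏ ∇ᵏ p 0.
--
-- As L [p (x) + p (x + 1)] = 2 p 0, the expansions A_b satisfy
-- A_b + q^(b+1) A_{b+2} = 2.  Multiplication by q⁻¹ = (1 + t) / (1 - t) replaces
-- coefficients by partial sums, so it preserves "eventually ≥ 1"; therefore the sign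
-- flips from b to b + 2, and only b = 1 and b = 2 remain.
--
-- From (1 - t²) (qᵉ)′ = - 2 e qᵉ, the numbers L [v · w_n (x² + b x)] obey a recurrence
-- in n that multiplies v by - 2 (x² + b x).  For b = 1 the signed Delannoy polynomials
-- (-1)ᵏ D_{2k} are mapped to non-negative combinations of each other, and L kills all
-- of them but D₀ = 1; so every coefficient of A₁ is ≥ 1.  For b = 2 the same computation
-- with D_{2k} (x) + D_{2k} (x + 1) gives A₂ = (1 + t) / (1 - t).

open import Defs
open import Algebra.Bundles using (CommutativeRing)
open import Data.Nat.Base as ℕ using (ℕ; zero; suc; _%_; NonZero)
open import Data.Nat.DivMod using (_/_; m≡m%n+[m/n]*n; m%n<n)
import Data.Nat.Properties as ℕ
open import Data.Nat.Tactic.RingSolver using (solve-∀)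
open import Data.Product.Base using (∃-syntax; _×_; _,_; proj₁; proj₂)
open import Data.Sum.Base using (_⊎_; inj₁; inj₂)
open import Function.Base using (_∘_)
open import Relation.Binary.PropositionalEquality.Core as ≡ using (_≡_)

-- Recursion by two successors lets degree bounds such as `suc (dbl n)` unfold definitionally, which
-- a product with 2 would not do.
dbl : ℕ → ℕ
dbl zero    = zero
dbl (suc n) = suc (suc (dbl n))

dbl≡2* : ∀ n → dbl n ≡ 2 ℕ.* n
dbl≡2* zero    = ≡.refl
dbl≡2* (suc n) = ≡.trans (≡.cong (suc ∘ suc) (dbl≡2* n)) (≡.sym (ℕ.*-suc 2 n))

dbl-mono : ∀ {m n} → m ℕ.≤ n → dbl m ℕ.≤ dbl n
dbl-mono ℕ.z≤n     = ℕ.z≤n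
dbl-mono (ℕ.s≤s p) = ℕ.s≤s (ℕ.s≤s (dbl-mono p))

e : ℕ → ℕ → ℕ
e b n = n ℕ.* n ℕ.+ b ℕ.* n

-- Ring solving with integer coefficients over an arbitrary commutative ring.

module IntegerCoefficients {c ℓ} (R : CommutativeRing c ℓ) where

  open import Algebra.Solver.Ring.AlmostCommutativeRing
    using (_-Raw-AlmostCommutative⟶_; fromCommutativeRing)
  open import Data.Integer.Base as ℤ using (ℤ; +_; -[1+_]; _⊖_; _◃_; +0; +[1+_])
  import Data.Integer.Properties as ℤ
  open import Data.Maybe.Base using (Maybe; just; nothing)
  import Data.Sign.Base as Sign
  open import Relation.Nullary.Decidable.Core using (yes; no)
  open CommutativeRing R
  open import Algebra.Properties.Ring ring
    using (-0#≈0#; -‿involutive; -‿+-comm; -‿distribˡ-*; -‿distribʳ-*)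
  open import Relation.Binary.Reasoning.Setoid setoid

  -- The separate clause for 1 makes the literals 1 and 2 evaluate to `1#` and `1# + 1#` on the
  -- nose, so solved equations match the goals as written.
  fromℕ : ℕ → Carrier
  fromℕ 0             = 0#
  fromℕ 1             = 1#
  fromℕ (suc (suc n)) = 1# + fromℕ (suc n)

  fromℤ : ℤ → Carrier
  fromℤ (+ n)    = fromℕ n
  fromℤ -[1+ n ] = - fromℕ (suc n)

  private
    fromℕ-suc : ∀ n → fromℕ (suc n) ≈ 1# + fromℕ n
    fromℕ-suc zero    = sym (+-identityʳ 1#)
    fromℕ-suc (suc n) = refl

    fromℕ-+ : ∀ m n → fromℕ (m ℕ.+ n) ≈ fromℕ m + fromℕ n
    fromℕ-+ zero    n = sym (+-identityˡ _)
    fromℕ-+ (suc m) n = begin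
      fromℕ (suc (m ℕ.+ n))       ≈⟨ fromℕ-suc (m ℕ.+ n) ⟩
      1# + fromℕ (m ℕ.+ n)        ≈⟨ +-congˡ (fromℕ-+ m n) ⟩
      1# + (fromℕ m + fromℕ n)    ≈⟨ +-assoc _ _ _ ⟨
      1# + fromℕ m + fromℕ n      ≈⟨ +-congʳ (fromℕ-suc m) ⟨
      fromℕ (suc m) + fromℕ n     ∎

    fromℕ-* : ∀ m n → fromℕ (m ℕ.* n) ≈ fromℕ m * fromℕ n
    fromℕ-* zero    n = sym (zeroˡ _)
    fromℕ-* (suc m) n = begin
      fromℕ (n ℕ.+ m ℕ.* n)            ≈⟨ fromℕ-+ n (m ℕ.* n) ⟩
      fromℕ n + fromℕ (m ℕ.* n)        ≈⟨ +-cong (sym (*-identityˡ _)) (fromℕ-* m n) ⟩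
      1# * fromℕ n + fromℕ m * fromℕ n ≈⟨ distribʳ _ _ _ ⟨
      (1# + fromℕ m) * fromℕ n         ≈⟨ *-congʳ (fromℕ-suc m) ⟨
      fromℕ (suc m) * fromℕ n          ∎

    fromℤ-neg : ∀ i → fromℤ (ℤ.- i) ≈ - fromℤ i
    fromℤ-neg -[1+ n ] = sym (-‿involutive _)
    fromℤ-neg +0       = sym -0#≈0#
    fromℤ-neg +[1+ n ] = refl

    fromℤ-⊖ : ∀ m n → fromℤ (m ⊖ n) ≈ fromℕ m - fromℕ n
    fromℤ-⊖ zero    zero    = sym (trans (+-congˡ -0#≈0#) (+-identityʳ 0#))
    fromℤ-⊖ zero    (suc n) = sym (+-identityˡ _)
    fromℤ-⊖ (suc m) zero    = sym (trans (+-congˡ -0#≈0#) (+-identityʳ _))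
    fromℤ-⊖ (suc m) (suc n) = begin
      fromℤ (suc m ⊖ suc n)                  ≡⟨ ≡.cong fromℤ (ℤ.[1+m]⊖[1+n]≡m⊖n m n) ⟩
      fromℤ (m ⊖ n)                          ≈⟨ fromℤ-⊖ m n ⟩
      fromℕ m - fromℕ n                      ≈⟨ +-congʳ (+-identityˡ _) ⟨
      0# + fromℕ m - fromℕ n                 ≈⟨ +-congʳ (+-congʳ (-‿inverseʳ 1#)) ⟨
      1# - 1# + fromℕ m - fromℕ n            ≈⟨ +-congʳ (+-assoc _ _ _) ⟩
      1# + (- 1# + fromℕ m) - fromℕ n        ≈⟨ +-congʳ (+-congˡ (+-comm _ _)) ⟩
      1# + (fromℕ m - 1#) - fromℕ n          ≈⟨ +-congʳ (+-assoc _ _ _) ⟨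
      1# + fromℕ m - 1# - fromℕ n            ≈⟨ +-assoc _ _ _ ⟩
      1# + fromℕ m + (- 1# - fromℕ n)        ≈⟨ +-congˡ (-‿+-comm _ _) ⟩
      1# + fromℕ m - (1# + fromℕ n)          ≈⟨ +-cong (fromℕ-suc m) (-‿cong (fromℕ-suc n)) ⟨
      fromℕ (suc m) - fromℕ (suc n)          ∎

    fromℤ-+ : ∀ i j → fromℤ (i ℤ.+ j) ≈ fromℤ i + fromℤ j
    fromℤ-+ -[1+ m ] -[1+ n ] = begin
      - fromℕ (suc (suc (m ℕ.+ n)))      ≡⟨ ≡.cong (λ k → - fromℕ (suc k)) (ℕ.+-suc m n) ⟨
      - fromℕ (suc m ℕ.+ suc n)          ≈⟨ -‿cong (fromℕ-+ (suc m) (suc n)) ⟩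
      - (fromℕ (suc m) + fromℕ (suc n))  ≈⟨ -‿+-comm _ _ ⟨
      - fromℕ (suc m) - fromℕ (suc n)    ∎
    fromℤ-+ -[1+ m ] (+ n)    = trans (fromℤ-⊖ n (suc m)) (+-comm _ _)
    fromℤ-+ (+ m)    -[1+ n ] = fromℤ-⊖ m (suc n)
    fromℤ-+ (+ m)    (+ n)    = fromℕ-+ m n

    fromℤ-+◃ : ∀ n → fromℤ (Sign.+ ◃ n) ≈ fromℕ n
    fromℤ-+◃ zero    = refl
    fromℤ-+◃ (suc n) = refl

    fromℤ--◃ : ∀ n → fromℤ (Sign.- ◃ n) ≈ - fromℕ n
    fromℤ--◃ zero    = sym -0#≈0#
    fromℤ--◃ (suc n) = refl

    fromℤ-* : ∀ i j → fromℤ (i ℤ.* j) ≈ fromℤ i * fromℤ j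
    fromℤ-* (+ m) (+ n) = trans (fromℤ-+◃ (m ℕ.* n)) (fromℕ-* m n)
    fromℤ-* (+ m) -[1+ n ] =
      trans (fromℤ--◃ (m ℕ.* suc n)) (trans (-‿cong (fromℕ-* m (suc n))) (-‿distribʳ-* _ _))
    fromℤ-* -[1+ m ] (+ n) =
      trans (fromℤ--◃ (suc m ℕ.* n)) (trans (-‿cong (fromℕ-* (suc m) n)) (-‿distribˡ-* _ _))
    fromℤ-* -[1+ m ] -[1+ n ] = begin
      fromℕ (suc m ℕ.* suc n)            ≈⟨ fromℕ-* (suc m) (suc n) ⟩
      fromℕ (suc m) * fromℕ (suc n)      ≈⟨ -‿involutive _ ⟨
      - - (fromℕ (suc m) * fromℕ (suc n)) ≈⟨ -‿cong (-‿distribˡ-* _ _) ⟩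
      - (- fromℕ (suc m) * fromℕ (suc n)) ≈⟨ -‿distribʳ-* _ _ ⟩
      - fromℕ (suc m) * - fromℕ (suc n)  ∎

    morphism : ℤ.+-*-rawRing -Raw-AlmostCommutative⟶ fromCommutativeRing R
    morphism = record
      { ⟦_⟧    = fromℤ
      ; +-homo = fromℤ-+
      ; *-homo = fromℤ-*
      ; -‿homo = fromℤ-neg
      ; 0-homo = refl
      ; 1-homo = refl
      }

    _≟_ : ∀ i j → Maybe (fromℤ i ≈ fromℤ j)
    i ≟ j with i ℤ.≟ j
    ... | yes i≡j = just (reflexive (≡.cong fromℤ i≡j))
    ... | no  _   = nothing

  open import Algebra.Solver.Ring ℤ.+-*-rawRing (fromCommutativeRing R) morphism _≟_ public
    using (Polynomial; solve; con; _:=_; _:+_; _:*_; _:-_; :-_)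

-- Inequalities and absolute-value bounds in a constructive ordered field.

module Ordered {c ℓ₁ ℓ₂} (ℝ : RealField c ℓ₁ ℓ₂) where

  open RealField ℝ public
  open Real ℝ public
  open IntegerCoefficients commutativeRing public
    using (Polynomial; solve; con; _:=_; _:+_; _:*_; _:-_; :-_)
  open import Algebra.Apartness.Properties.HeytingCommutativeRing heytingCommutativeRing public
    using (x-0≈x; invertibleʳ⇒#)
  open import Algebra.Properties.Ring ring public using (-0#≈0#; -‿involutive)
  open import Algebra.Properties.Semiring.Exp semiring public
    using (^-homo-*; ^-congʳ; ^-congˡ; ^-assocʳ)
  open import Algebra.Properties.CommutativeSemiring.Exp (CommutativeRing.commutativeSemiring commutativeRing) public
    using (^-distrib-*)
  open import Algebra.Properties.Semiring.Mult semiring public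
    using (×1-homo-*; ×-homo-+)
  open import Data.Integer.Base using (+_)

  infix 4 _≼_

  :0 :1 :2 : ∀ {n} → Polynomial n
  :0 = con (+ 0)
  :1 = con (+ 1)
  :2 = con (+ 2)

  ι : ℕ → Carrier
  ι n = n · 1#

  ≤-reflexive : ∀ {x y} → x ≈ y → x ≤ y
  ≤-reflexive x≈y = ≤-resp refl x≈y ≤-refl

  -- Apartness is tight: were x and y apart, one strict inequality would hold, and both are
  -- excluded.
  ≤-antisym : ∀ {x y} → x ≤ y → y ≤ x → x ≈ y
  ≤-antisym {x} {y} x≤y y≤x = proj₁ (tight x y) λ x#y → case (#⇒<⊎> x#y)
    where
    case : x < y ⊎ y < x → _
    case (inj₁ x<y) = y≤x x<y
    case (inj₂ y<x) = x≤y y<x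

  +-mono-≤ : ∀ {x x′ y y′} → x ≤ x′ → y ≤ y′ → x + y ≤ x′ + y′
  +-mono-≤ {x} {x′} {y} {y′} p p′ =
    ≤-trans (+-monoʳ-≤ x p′) (≤-resp (+-comm _ _) (+-comm _ _) (+-monoʳ-≤ y′ p))

  ≤⇒0≤ : ∀ {x y} → x ≤ y → 0# ≤ y - x
  ≤⇒0≤ {x} x≤y = ≤-resp (-‿inverseʳ x) refl (+-mono-≤ x≤y ≤-refl)

  0≤⇒≤ : ∀ {x y} → 0# ≤ y - x → x ≤ y
  0≤⇒≤ {x} {y} p = ≤-resp (+-identityˡ x) (x-y+y y x) (+-mono-≤ p ≤-refl)

  +-nonneg : ∀ {x y} → 0# ≤ x → 0# ≤ y → 0# ≤ x + y
  +-nonneg p p′ = ≤-resp (+-identityˡ 0#) refl (+-mono-≤ p p′)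

  -- A negative product is invertible, hence so is its factor x.
  *-nonneg : ∀ {x y} → 0# ≤ x → 0# ≤ y → 0# ≤ x * y
  *-nonneg {x} {y} 0≤x 0≤y xy<0 = case (#⇒<⊎> (invertibleʳ⇒# {x} {0#} (y * i , eq)))
    where
    i = proj₁ (#⇒invertible (<⇒# xy<0))

    eq : (x - 0#) * (y * i) ≈ 1#
    eq = trans (solve 3 (λ x y i → (x :- :0) :* (y :* i) := (x :* y :- :0) :* i) refl x y i)
      (proj₂ (proj₂ (#⇒invertible (<⇒# xy<0))))

    case : x < 0# ⊎ 0# < x → _
    case (inj₁ x<0) = 0≤x x<0
    case (inj₂ 0<x) = ≤-resp (zeroʳ x) refl (*-monoˡ-≤ 0<x 0≤y) xy<0

  *-monoʳ-≤ : ∀ {x y z} → 0# ≤ z → x ≤ y → z * x ≤ z * y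
  *-monoʳ-≤ {x} {y} {z} 0≤z x≤y = 0≤⇒≤ (≤-resp refl
    (solve 3 (λ x y z → z :* (y :- x) := z :* y :- z :* x) refl x y z) (*-nonneg 0≤z (≤⇒0≤ x≤y)))

  *-mono-≤ : ∀ {x x′ y y′} → 0# ≤ x → 0# ≤ y → x ≤ x′ → y ≤ y′ → x * y ≤ x′ * y′
  *-mono-≤ {x} {x′} {y} {y′} 0≤x 0≤y p p′ = ≤-trans (*-monoʳ-≤ 0≤x p′)
    (≤-resp (*-comm _ _) (*-comm _ _) (*-monoʳ-≤ (≤-trans 0≤y p′) p))

  *-cancelˡ-≤ : ∀ {x y z} → 0# < z → z * x ≤ z * y → x ≤ y
  *-cancelˡ-≤ 0<z p = p ∘ *-monoˡ-< 0<z

  *-cancelˡ-≈ : ∀ {x y z} → 0# < z → z * x ≈ z * y → x ≈ y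
  *-cancelˡ-≈ 0<z p =
    ≤-antisym (*-cancelˡ-≤ 0<z (≤-reflexive p)) (*-cancelˡ-≤ 0<z (≤-reflexive (sym p)))

  0≤1 : 0# ≤ 1#
  0≤1 = <⇒≤ 0<1

  0<2 : 0# < 1# + 1#
  0<2 = 0<1+t 0<1

  ^-nonneg : ∀ {x} → 0# ≤ x → ∀ n → 0# ≤ x ^ n
  ^-nonneg 0≤x zero    = 0≤1
  ^-nonneg 0≤x (suc n) = *-nonneg 0≤x (^-nonneg 0≤x n)

  ^-mono-≤ : ∀ {x y} → 0# ≤ x → x ≤ y → ∀ n → x ^ n ≤ y ^ n
  ^-mono-≤ 0≤x x≤y zero    = ≤-refl
  ^-mono-≤ 0≤x x≤y (suc n) = *-mono-≤ 0≤x (^-nonneg 0≤x n) x≤y (^-mono-≤ 0≤x x≤y n)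

  1^n≈1 : ∀ n → 1# ^ n ≈ 1#
  1^n≈1 zero    = refl
  1^n≈1 (suc n) = trans (*-identityˡ _) (1^n≈1 n)

  ι-mono : ∀ {m n} → m ℕ.≤ n → ι m ≤ ι n
  ι-mono {n = n} ℕ.z≤n     = 0≤n·1 n
  ι-mono         (ℕ.s≤s p) = +-monoʳ-≤ 1# (ι-mono p)

  0<ι-suc : ∀ n → 0# < ι (suc n)
  0<ι-suc n = <-≤-trans 0<1 (≤-resp (+-identityʳ 1#) refl (+-monoʳ-≤ 1# (0≤n·1 n)))

  ι-+ : ∀ m n → ι (m ℕ.+ n) ≈ ι m + ι n
  ι-+ = ×-homo-+ 1#

  ι-* : ∀ m n → ι (m ℕ.* n) ≈ ι m * ι n
  ι-* = ×1-homo-*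

  -- x ≼ y says |x| ≤ y.
  _≼_ : Carrier → Carrier → Set ℓ₂
  x ≼ y = (x ≤ y) × (- x ≤ y)

  ≼-resp : ∀ {x x′ y y′} → x ≈ x′ → y ≈ y′ → x ≼ y → x′ ≼ y′
  ≼-resp p p′ (a , b) = ≤-resp p p′ a , ≤-resp (-‿cong p) p′ b

  ≼-weaken : ∀ {x y y′} → x ≼ y → y ≤ y′ → x ≼ y′
  ≼-weaken (a , b) p = ≤-trans a p , ≤-trans b p

  ≼-nonneg : ∀ {x y} → 0# ≤ x → x ≤ y → x ≼ y
  ≼-nonneg 0≤x x≤y = x≤y , ≤-trans (≤-resp refl -0#≈0# (neg-anti-≤ 0≤x)) (≤-trans 0≤x x≤y)

  ≼-0 : ∀ {y} → 0# ≤ y → 0# ≼ y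
  ≼-0 = ≼-nonneg ≤-refl

  ≼-+ : ∀ {x y a b} → x ≼ a → y ≼ b → x + y ≼ a + b
  ≼-+ {x} {y} (p , p′) (r , r′) = +-mono-≤ p r ,
    ≤-resp (solve 2 (λ x y → :- x :+ :- y := :- (x :+ y)) refl x y) refl (+-mono-≤ p′ r′)

  ≼-neg : ∀ {x a} → x ≼ a → - x ≼ a
  ≼-neg (p , p′) = p′ , ≤-resp (sym (-‿involutive _)) refl p

  ≼-- : ∀ {x y a b} → x ≼ a → y ≼ b → x - y ≼ a + b
  ≼-- p r = ≼-+ p (≼-neg r)

  ≼-scale : ∀ {z x a} → 0# ≤ z → x ≼ a → z * x ≼ z * a
  ≼-scale {z} {x} 0≤z (p , p′) = *-monoʳ-≤ 0≤z p ,
    ≤-resp (solve 2 (λ z x → z :* :- x := :- (z :* x)) refl z x) refl (*-monoʳ-≤ 0≤z p′)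

  ≼-bound-nonneg : ∀ {x a} → x ≼ a → 0# ≤ a
  ≼-bound-nonneg {x} {a} (p , p′) = *-cancelˡ-≤ 0<2
    (≤-resp (solve 1 (λ x → x :+ :- x := :2 :* :0) refl x)
            (solve 1 (λ a → a :+ a := :2 :* a) refl a) (+-mono-≤ p p′))

  ≼-sign : ∀ m {x a} → x ≼ a → (- 1#) ^ m * x ≼ a
  ≼-sign zero    {x} p = ≼-resp (sym (*-identityˡ x)) refl p
  ≼-sign (suc m) {x} p = ≼-resp
    (solve 2 (λ s x → :- (s :* x) := (:- :1 :* s) :* x) refl ((- 1#) ^ m) x) refl
    (≼-neg (≼-sign m p))

  <-+ˡ : ∀ {x y} → 0# < x → y < x + y
  <-+ˡ {x} {y} 0<x = <-resp (+-identityˡ y) refl (+-monoˡ-< y 0<x)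

  -- The order is undecidable, so min x y is not available.
  below : ∀ x y → 0# < x → 0# < y → ∃[ z ] (0# < z × z < x × z < y)
  below x y 0<x 0<y = z , *-pos (*-pos 0<x 0<y) (inv-pos s 0<s) ,
    *-cancelˡ-< 0<s (<-resp (sym s*z) (sym (distribʳ x x y)) (<-resp refl (+-congˡ (*-comm x y)) (<-+ˡ (*-pos 0<x 0<x)))) ,
    *-cancelˡ-< 0<s (<-resp (sym s*z) (trans (+-comm _ _) (sym (distribʳ y x y))) (<-+ˡ (*-pos 0<y 0<y)))
    where
    s = x + y

    0<s : 0# < s
    0<s = <-≤-trans 0<x (≤-resp (+-identityʳ x) refl (+-monoʳ-≤ x (<⇒≤ 0<y)))

    z = x * y * inv s 0<s

    s*z : s * z ≈ x * y
    s*z = trans (*-comm _ _)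
      (trans (*-assoc _ _ _) (trans (*-congˡ (inv-inverseˡ s 0<s)) (*-identityʳ _)))

-- Finite differences, Euler's transformation and its truncation error.

module Analysis {c ℓ₁ ℓ₂} (ℝ : RealField c ℓ₁ ℓ₂) where
  open Ordered ℝ
  open import Relation.Binary.Reasoning.Setoid setoid

  ∇ : (ℕ → Carrier) → ℕ → Carrier
  ∇ v n = v n - v (suc n)

  ∇^ : ℕ → (ℕ → Carrier) → ℕ → Carrier
  ∇^ zero    v = v
  ∇^ (suc M) v = ∇^ M (∇ v)

  ½ : Carrier
  ½ = inv (1# + 1#) 0<2

  -- Euler's transformation of the formal sum 2 ∑ (-1)ⁿ v n, truncated to M terms.
  L : ℕ → (ℕ → Carrier) → Carrier
  L zero    v = 0#
  L (suc M) v = v 0 + ½ * L M (∇ v)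

  ∇-cong : ∀ {v w} → (∀ n → v n ≈ w n) → ∀ n → ∇ v n ≈ ∇ w n
  ∇-cong p n = +-cong (p n) (-‿cong (p (suc n)))

  ∇-lin : ∀ a b v w n → ∇ (λ n → a * v n + b * w n) n ≈ a * ∇ v n + b * ∇ w n
  ∇-lin a b v w n = solve 6 (λ a b v w v′ w′ →
      (a :* v :+ b :* w) :- (a :* v′ :+ b :* w′) := a :* (v :- v′) :+ b :* (w :- w′))
    refl a b (v n) (w n) (v (suc n)) (w (suc n))

  ∇^-cong : ∀ M {v w} → (∀ n → v n ≈ w n) → ∀ n → ∇^ M v n ≈ ∇^ M w n
  ∇^-cong zero    p n = p n
  ∇^-cong (suc M) p n = ∇^-cong M (∇-cong p) n

  ∇^-lin : ∀ M a b v w n → ∇^ M (λ n → a * v n + b * w n) n ≈ a * ∇^ M v n + b * ∇^ M w n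
  ∇^-lin zero    a b v w n = refl
  ∇^-lin (suc M) a b v w n =
    trans (∇^-cong M (∇-lin a b v w) n) (∇^-lin M a b (∇ v) (∇ w) n)

  ∇^-shift : ∀ M v n → ∇^ M (v ∘ suc) n ≈ ∇^ M v (suc n)
  ∇^-shift zero    v n = refl
  ∇^-shift (suc M) v n = ∇^-shift M (∇ v) n

  L-cong : ∀ M {v w} → (∀ n → v n ≈ w n) → L M v ≈ L M w
  L-cong zero    p = refl
  L-cong (suc M) p = +-cong (p 0) (*-congˡ (L-cong M (∇-cong p)))

  L-lin : ∀ M a b v w → L M (λ n → a * v n + b * w n) ≈ a * L M v + b * L M w
  L-lin zero    a b v w = solve 2 (λ a b → :0 := a :* :0 :+ b :* :0) refl a b
  L-lin (suc M) a b v w = begin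
    a * v 0 + b * w 0 + ½ * L M (∇ λ n → a * v n + b * w n)
      ≈⟨ +-congˡ (*-congˡ (trans (L-cong M (∇-lin a b v w)) (L-lin M a b (∇ v) (∇ w)))) ⟩
    a * v 0 + b * w 0 + ½ * (a * L M (∇ v) + b * L M (∇ w))
      ≈⟨ solve 7 (λ a b v w h x y → a :* v :+ b :* w :+ h :* (a :* x :+ b :* y)
            := a :* (v :+ h :* x) :+ b :* (w :+ h :* y))
           refl a b (v 0) (w 0) ½ (L M (∇ v)) (L M (∇ w)) ⟩
    a * L (suc M) v + b * L (suc M) w ∎

  0≤½ : 0# ≤ ½
  0≤½ = <⇒≤ (inv-pos _ 0<2)

  ½+½ : ∀ x → ½ * x + ½ * x ≈ x
  ½+½ x = trans (solve 2 (λ h x → h :* x :+ h :* x := h :* :2 :* x) refl ½ x)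
    (trans (*-congʳ (inv-inverseˡ _ 0<2)) (*-identityˡ x))

  ∑-snoc : ∀ u n → ∑< (suc n) u ≈ ∑< n u + u n
  ∑-snoc u zero    = +-comm _ _
  ∑-snoc u (suc n) = trans (+-congˡ (∑-snoc (u ∘ suc) n)) (sym (+-assoc _ _ _))

  T : ℕ → (ℕ → Carrier) → Carrier
  T J v = ∑< J (alternating v)

  -- Summation by parts: shifting one of the two copies of T pairs neighbouring terms into
  -- differences and leaves two boundary terms.
  T-∇ : ∀ J v → (1# + 1#) * T J v ≈ v 0 - (- 1#) ^ J * v J + T J (∇ v)
  T-∇ zero    v = solve 1 (λ x → :2 :* :0 := x :- :1 :* x :+ :0) refl (v 0)
  T-∇ (suc J) v = begin
    (1# + 1#) * T (suc J) v                ≈⟨ *-congˡ (∑-snoc (alternating v) J) ⟩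
    (1# + 1#) * (T J v + s * v J)          ≈⟨ distribˡ _ _ _ ⟩
    (1# + 1#) * T J v + (1# + 1#) * (s * v J) ≈⟨ +-congʳ (T-∇ J v) ⟩
    v 0 - s * v J + T J (∇ v) + (1# + 1#) * (s * v J)
      ≈⟨ solve 5 (λ v₀ s x y τ → v₀ :- s :* x :+ τ :+ :2 :* (s :* x)
           := v₀ :- (:- :1 :* s) :* y :+ (τ :+ s :* (x :- y)))
           refl (v 0) s (v J) (v (suc J)) (T J (∇ v)) ⟩
    v 0 - - 1# * s * v (suc J) + (T J (∇ v) + s * ∇ v J)
      ≈⟨ +-congˡ (∑-snoc (alternating (∇ v)) J) ⟨
    v 0 - (- 1#) ^ suc J * v (suc J) + T (suc J) (∇ v) ∎
    where
    s = (- 1#) ^ J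

  module _ {q} (0<q : 0# < q) (q<1 : q < 1#) where

    private
      0≤q = <⇒≤ 0<q

    0≤1-q : 0# ≤ 1# - q
    0≤1-q = <⇒≤ (x<y⇒0<y-x q<1)

    0≤q^ : ∀ n → 0# ≤ q ^ n
    0≤q^ n = <⇒≤ (^-pos 0<q n)

    -- The absolute values already sum to a telescoping series, as (1 - q) qⁿ = qⁿ - qⁿ⁺¹.
    T-bound : ∀ Y v → (∀ n → v n ≼ Y * (1# - q) * q ^ n) → ∀ J → T J v ≼ Y * (1# - q ^ J)
    T-bound Y v p zero = ≼-0 (≤-reflexive (solve 1 (λ Y → :0 := Y :* (:1 :- :1)) refl Y))
    T-bound Y v p (suc J) = ≼-resp (sym (∑-snoc (alternating v) J))
      (solve 3 (λ Y q Q → Y :* (:1 :- Q) :+ Y :* (:1 :- q) :* Q := Y :* (:1 :- q :* Q)) refl Y q (q ^ J))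
      (≼-+ (T-bound Y v p J) (≼-sign J (p J)))

    -- Induction on M through `T-∇`: each step halves the earlier error and adds a boundary term of
    -- size at most Z qᴶ. Halving 2 (Y + Z qᴶ) leaves room for that term, so Y and Z stay fixed.
    Euler-bound : ∀ M Y Z v → 0# ≤ Y → 0# ≤ Z →
      (∀ k n → k ℕ.< M → ∇^ k v n ≼ Z * q ^ n) →
      (∀ n → ∇^ M v n ≼ Y * (1# - q) * q ^ n) →
      ∀ J → (1# + 1#) * T J v - L M v ≼ (1# + 1#) * (Y + Z * q ^ J)
    Euler-bound zero Y Z v 0≤Y 0≤Z small tiny J =
      ≼-resp (sym (x-0≈x _)) refl (≼-scale (<⇒≤ 0<2) (≼-weaken (T-bound Y v tiny J)
        (0≤⇒≤ (≤-resp refl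
          (solve 3 (λ Y Z Q → Y :* Q :+ Z :* Q := (Y :+ Z :* Q) :- Y :* (:1 :- Q)) refl Y Z (q ^ J))
          (+-nonneg (*-nonneg 0≤Y (0≤q^ J)) (*-nonneg 0≤Z (0≤q^ J)))))))
    Euler-bound (suc M) Y Z v 0≤Y 0≤Z small tiny J = ≼-weaken (≼-resp (sym eq) refl
        (≼-- (≼-scale 0≤½ (Euler-bound M Y Z (∇ v) 0≤Y 0≤Z
                (λ k n k<M → small (suc k) n (ℕ.s≤s k<M)) tiny J))
             (≼-sign J (small 0 J (ℕ.s≤s ℕ.z≤n)))))
      (0≤⇒≤ (≤-resp refl eq′ 0≤Y))
      where
      s = (- 1#) ^ J
      X = Y + Z * q ^ J

      eq : (1# + 1#) * T J v - L (suc M) v ≈ ½ * ((1# + 1#) * T J (∇ v) - L M (∇ v)) - s * v J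
      eq = begin
        (1# + 1#) * T J v - L (suc M) v
          ≈⟨ +-congʳ (T-∇ J v) ⟩
        v 0 - s * v J + T J (∇ v) - (v 0 + ½ * L M (∇ v))
          ≈⟨ +-congʳ (+-congˡ (½+½ (T J (∇ v)))) ⟨
        v 0 - s * v J + (½ * T J (∇ v) + ½ * T J (∇ v)) - (v 0 + ½ * L M (∇ v))
          ≈⟨ solve 5 (λ v₀ x h τ l → v₀ :- x :+ (h :* τ :+ h :* τ) :- (v₀ :+ h :* l)
               := h :* (:2 :* τ :- l) :- x) refl (v 0) (s * v J) ½ (T J (∇ v)) (L M (∇ v)) ⟩
        ½ * ((1# + 1#) * T J (∇ v) - L M (∇ v)) - s * v J ∎

      -- The slack of the inductive step is exactly Y: half of 2 X plus Z qᴶ is 2 X - Y.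
      eq′ : Y ≈ (1# + 1#) * X - (½ * ((1# + 1#) * X) + Z * q ^ J)
      eq′ = begin
        Y
          ≈⟨ solve 2 (λ Y z → Y := :2 :* (Y :+ z) :- ((Y :+ z) :+ z)) refl Y (Z * q ^ J) ⟩
        (1# + 1#) * X - (X + Z * q ^ J)
          ≈⟨ +-congˡ (-‿cong (+-congʳ (trans (sym (½+½ X))
               (solve 2 (λ h x → h :* x :+ h :* x := h :* (:2 :* x)) refl ½ X)))) ⟩
        (1# + 1#) * X - (½ * ((1# + 1#) * X) + Z * q ^ J) ∎

    1-q^≤ : ∀ m → 1# - q ^ m ≤ ι m * (1# - q)
    1-q^≤ zero    = ≤-reflexive (solve 1 (λ q → :1 :- :1 := :0 :* (:1 :- q)) refl q)
    1-q^≤ (suc m) = ≤-trans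
      (0≤⇒≤ (≤-resp refl
        (solve 2 (λ q Q → (:1 :- q) :* (:1 :- Q) := ((:1 :- q) :+ (:1 :- Q)) :- (:1 :- q :* Q)) refl q (q ^ m))
        (*-nonneg 0≤1-q (≤⇒0≤ (^-≤-1 0<q q<1 m)))))
      (≤-resp refl (solve 2 (λ q i → (:1 :- q) :+ i :* (:1 :- q) := (:1 :+ i) :* (:1 :- q)) refl q (ι m))
        (+-monoʳ-≤ (1# - q) (1-q^≤ m)))

    -- Bernoulli's inequality for q ^ (E / k), raised to the power k.
    q^-decay : ∀ E k → q ^ E * (ι (suc E) * (1# - q)) ^ k ≤ ι k ^ k
    q^-decay E zero    = ≤-resp (sym (*-identityʳ _)) refl (^-≤-1 0<q q<1 E)
    q^-decay E k@(suc _) = ≤-trans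
      (*-mono-≤ (0≤q^ E) (^-nonneg 0≤x k) (^-antitone 0<q q<1 mk≤E) (^-mono-≤ 0≤x x≤ k))
      (≤-trans (≤-reflexive eq) (≤-resp refl (*-identityʳ _)
        (*-monoʳ-≤ (^-nonneg (0≤n·1 k) k) (≤-resp refl (1^n≈1 k) (^-mono-≤ 0≤y y≤1 k)))))
      where
      -- Division with remainder brackets E: m k ≤ E < k (m + 1), so qᴱ ≤ (qᵐ)ᵏ and E + 1 ≤ k (m +
      -- 1).
      m = E / k
      h = 1# - q
      y = q ^ m * (ι (suc m) * h)

      0≤x : 0# ≤ ι (suc E) * h
      0≤x = *-nonneg (0≤n·1 (suc E)) 0≤1-q

      0≤y : 0# ≤ y
      0≤y = *-nonneg (0≤q^ m) (*-nonneg (0≤n·1 (suc m)) 0≤1-q)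

      mk≤E : m ℕ.* k ℕ.≤ E
      mk≤E = ≡.subst (m ℕ.* k ℕ.≤_) (≡.sym (m≡m%n+[m/n]*n E k)) (ℕ.m≤n+m (m ℕ.* k) (E % k))

      E<k[1+m] : suc E ℕ.≤ k ℕ.* suc m
      E<k[1+m] = ≡.subst₂ ℕ._≤_ (≡.cong suc (≡.sym (m≡m%n+[m/n]*n E k))) (ℕ.*-comm (suc m) k)
        (ℕ.+-monoˡ-≤ (m ℕ.* k) (m%n<n E k))

      x≤ : ι (suc E) * h ≤ ι k * (ι (suc m) * h)
      x≤ = ≤-resp refl (trans (*-congʳ (ι-* k (suc m))) (*-assoc _ _ _))
        (*-mono-≤ (0≤n·1 (suc E)) 0≤1-q (ι-mono E<k[1+m]) ≤-refl)

      y≤1 : y ≤ 1#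
      y≤1 = ≤-trans (*-monoʳ-≤ (0≤q^ m) (0≤⇒≤ (≤-resp refl
          (solve 2 (λ q i → q := (:1 :+ i :* (:1 :- q)) :- (:1 :+ i) :* (:1 :- q)) refl q (ι m)) 0≤q)))
        (bernoulli 0<q q<1 m)

      eq : q ^ (m ℕ.* k) * (ι k * (ι (suc m) * h)) ^ k ≈ ι k ^ k * y ^ k
      eq = begin
        q ^ (m ℕ.* k) * (ι k * (ι (suc m) * h)) ^ k
          ≈⟨ *-cong (sym (^-assocʳ q m k)) (^-distrib-* (ι k) _ k) ⟩
        (q ^ m) ^ k * (ι k ^ k * (ι (suc m) * h) ^ k)
          ≈⟨ solve 3 (λ a b c → a :* (b :* c) := b :* (a :* c)) refl ((q ^ m) ^ k) (ι k ^ k) ((ι (suc m) * h) ^ k) ⟩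
        ι k ^ k * ((q ^ m) ^ k * (ι (suc m) * h) ^ k)
          ≈⟨ *-congˡ (sym (^-distrib-* (q ^ m) _ k)) ⟩
        ι k ^ k * y ^ k ∎

-- Differences of q^(n² + b n), bounded uniformly in q and n.

module Euler {c ℓ₁ ℓ₂} (ℝ : RealField c ℓ₁ ℓ₂) where
  open Ordered ℝ
  open Analysis ℝ
  open import Relation.Binary.Reasoning.Setoid setoid

  -- The q-Pochhammer symbol: the product of 1 - z pⁱ over i < K.
  π : Carrier → ℕ → Carrier → Carrier
  π p zero    z = 1#
  π p (suc K) z = (1# - z) * π p K (z * p)

  π-cong : ∀ p K {z z′} → z ≈ z′ → π p K z ≈ π p K z′
  π-cong p zero    z≈ = refl
  π-cong p (suc K) z≈ = *-cong (+-congˡ (-‿cong z≈)) (π-cong p K (*-congʳ z≈))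

  π-snoc : ∀ p K z → π p (suc K) z ≈ π p K z * (1# - z * p ^ K)
  π-snoc p zero    z = solve 1 (λ z → (:1 :- z) :* :1 := :1 :* (:1 :- z :* :1)) refl z
  π-snoc p (suc K) z = begin
    (1# - z) * π p (suc K) (z * p)                    ≈⟨ *-congˡ (π-snoc p K (z * p)) ⟩
    (1# - z) * (π p K (z * p) * (1# - z * p * p ^ K))
      ≈⟨ solve 4 (λ z p P Q → (:1 :- z) :* (P :* (:1 :- z :* p :* Q)) := (:1 :- z) :* P :* (:1 :- z :* (p :* Q)))
           refl z p (π p K (z * p)) (p ^ K) ⟩
    π p (suc K) z * (1# - z * p ^ suc K)              ∎

  module _ {p} (0≤p : 0# ≤ p) (p≤1 : p ≤ 1#) where

    private
      scaled-≤1 : ∀ {z} → 0# ≤ z → z ≤ 1# → z * p ≤ 1#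
      scaled-≤1 0≤z z≤1 = ≤-resp refl (*-identityʳ 1#) (*-mono-≤ 0≤z 0≤p z≤1 p≤1)

    π-nonneg : ∀ K {z} → 0# ≤ z → z ≤ 1# → 0# ≤ π p K z
    π-nonneg zero    0≤z z≤1 = 0≤1
    π-nonneg (suc K) 0≤z z≤1 =
      *-nonneg (≤⇒0≤ z≤1) (π-nonneg K (*-nonneg 0≤z 0≤p) (scaled-≤1 0≤z z≤1))

    1-zp^-mono : ∀ K {z} → 0# ≤ z → 1# - z ≤ 1# - z * p ^ K
    1-zp^-mono K {z} 0≤z = +-monoʳ-≤ 1# (neg-anti-≤ (≤-resp refl (*-identityʳ z)
      (*-monoʳ-≤ 0≤z (≤-resp refl (1^n≈1 K) (^-mono-≤ 0≤p p≤1 K)))))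

    -- The factors 1 - z pⁱ increase with i, so j of them are bounded by 1 - z pᴷ; the remaining
    -- ones are bounded by 1.
    π-bound : ∀ K j {z} → j ℕ.≤ K → 0# ≤ z → z ≤ 1# → π p K z ≤ (1# - z * p ^ K) ^ j
    π-bound zero    zero    j≤K 0≤z z≤1 = ≤-refl
    π-bound (suc K) zero    j≤K 0≤z z≤1 = ≤-resp refl (*-identityʳ 1#)
      (*-mono-≤ (≤⇒0≤ z≤1) (π-nonneg K (*-nonneg 0≤z 0≤p) (scaled-≤1 0≤z z≤1))
        (≤-resp refl (x-0≈x 1#) (+-monoʳ-≤ 1# (neg-anti-≤ 0≤z)))
        (π-bound K 0 ℕ.z≤n (*-nonneg 0≤z 0≤p) (scaled-≤1 0≤z z≤1)))
    π-bound (suc K) (suc j) {z} (ℕ.s≤s j≤K) 0≤z z≤1 =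
      *-mono-≤ (≤⇒0≤ z≤1) (π-nonneg K (*-nonneg 0≤z 0≤p) (scaled-≤1 0≤z z≤1))
        (1-zp^-mono (suc K) 0≤z)
        (≤-resp refl (^-congˡ j (+-congˡ (-‿cong (*-assoc _ _ _))))
          (π-bound K j j≤K (*-nonneg 0≤z 0≤p) (scaled-≤1 0≤z z≤1)))

  g : ℕ → Carrier → ℕ → Carrier
  g b q n = q ^ e b n

  ratio : ℕ → Carrier → ℕ → Carrier
  ratio b q n = q ^ (n ℕ.+ n ℕ.+ suc b)

  g-suc : ∀ b q n → g b q (suc n) ≈ g b q n * ratio b q n
  g-suc b q n = trans (^-congʳ q (eq b n)) (^-homo-* q (e b n) (n ℕ.+ n ℕ.+ suc b))
    where
    eq : ∀ b n → suc n ℕ.* suc n ℕ.+ b ℕ.* suc n ≡ n ℕ.* n ℕ.+ b ℕ.* n ℕ.+ (n ℕ.+ n ℕ.+ suc b)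
    eq = solve-∀

  ratio-suc : ∀ b q n → ratio b q (suc n) ≈ ratio b q n * q ^ 2
  ratio-suc b q n = trans (^-congʳ q (eq b n)) (^-homo-* q (n ℕ.+ n ℕ.+ suc b) 2)
    where
    eq : ∀ b n → suc n ℕ.+ suc n ℕ.+ suc b ≡ n ℕ.+ n ℕ.+ suc b ℕ.+ 2
    eq = solve-∀

  u : ℕ → Carrier → ℕ → ℕ → Carrier
  u b q K n = g b q n * π (q ^ 2) K (ratio b q n)

  u-suc : ∀ b q K n → u b q K (suc n) ≈ g b q n * (ratio b q n * π (q ^ 2) K (ratio b q n * q ^ 2))
  u-suc b q K n = trans (*-cong (g-suc b q n) (π-cong (q ^ 2) K (ratio-suc b q n))) (*-assoc _ _ _)

  ∇u-zero : ∀ b q n → ∇ (u b q 0) n ≈ u b q 1 n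
  ∇u-zero b q n = trans (+-congˡ (-‿cong (u-suc b q 0 n)))
    (solve 2 (λ g z → g :* :1 :- g :* (z :* :1) := g :* ((:1 :- z) :* :1)) refl (g b q n) (ratio b q n))

  -- After the shift of n the product starts one factor later, so both terms of the difference share
  -- the product P; the remaining linear factors split into the two summands.
  ∇u-suc : ∀ b q K n →
    ∇ (u b q (suc K)) n ≈ 1# * u b q (2 ℕ.+ K) n + (- (1# - (q ^ 2) ^ suc K)) * u b q K (suc n)
  ∇u-suc b q K n = begin
    u b q (suc K) n - u b q (suc K) (suc n)
      ≈⟨ +-congˡ (-‿cong (trans (u-suc b q (suc K) n) (*-congˡ (*-congˡ (π-snoc p K (z * p)))))) ⟩
    G * ((1# - z) * P) - G * (z * (P * (1# - z * p * p ^ K)))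
      ≈⟨ solve 5 (λ G z P p Q →
           G :* ((:1 :- z) :* P) :- G :* (z :* (P :* (:1 :- z :* p :* Q)))
             := :1 :* (G :* ((:1 :- z) :* (P :* (:1 :- z :* p :* Q))))
                  :+ (:- (:1 :- p :* Q)) :* (G :* (z :* P)))
           refl G z P p (p ^ K) ⟩
    1# * (G * ((1# - z) * (P * (1# - z * p * p ^ K)))) + (- (1# - p ^ suc K)) * (G * (z * P))
      ≈⟨ +-cong (*-congˡ (*-congˡ (*-congˡ (π-snoc p K (z * p))))) (*-congˡ (u-suc b q K n)) ⟨
    1# * u b q (2 ℕ.+ K) n + (- (1# - p ^ suc K)) * u b q K (suc n) ∎
    where
    p = q ^ 2
    G = g b q n
    z = ratio b q n
    P = π p K (z * p)

  -- The constant is chosen before q, since q later tends to 1 with t; the factor qⁿ is kept for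
  -- summing over n.
  UniformBound : (Carrier → ℕ → Carrier) → ℕ → Set _
  UniformBound v i = ∃[ C ] (0# ≤ C) ×
    (∀ {q} → 0# < q → q < 1# → ∀ n → v q n ≼ C * (1# - q) ^ i * q ^ n)

  -- Using 2 i of the Pochhammer factors gives (1 - q)²ⁱ times a polynomial of degree 2 i in n.
  -- `q^-decay` spends i of these powers to absorb the growth in n against q^(n²); i powers remain.
  -- The positive index `suc b` supplies the factor qⁿ.
  u-bound : ∀ b K i → 2 ℕ.* i ℕ.≤ K → UniformBound (λ q → u (suc b) q K) i
  u-bound b K i 2i≤K = ι d ^ i * ι i ^ i ,
      *-nonneg (^-nonneg (0≤n·1 d) i) (^-nonneg (0≤n·1 i) i) , bound
    where
    k = 2 ℕ.+ b ℕ.+ 2 ℕ.* K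
    d = k ℕ.* k ℕ.* 2

    bound : ∀ {q} → 0# < q → q < 1# → ∀ n →
      u (suc b) q K n ≼ ι d ^ i * ι i ^ i * (1# - q) ^ i * q ^ n
    bound {q} 0<q q<1 n = ≼-nonneg (*-nonneg (0≤q^′ (e (suc b) n)) (π-nonneg 0≤p p≤1 K 0≤z z≤1))
      (≤-trans (*-mono-≤ (0≤q^′ (e (suc b) n)) (π-nonneg 0≤p p≤1 K 0≤z z≤1) G≤
                 (≤-trans (π-bound 0≤p p≤1 K (2 ℕ.* i) 2i≤K 0≤z z≤1)
                   (≤-resp (^-assocʳ X 2 i) (^-distrib-* (ι d * h) (ι (suc (n ℕ.* n)) * h) i) (^-mono-≤ (^-nonneg 0≤X 2) X²≤ i))))
        (≤-resp eq₁ eq₂ (*-monoʳ-≤ (*-nonneg (^-nonneg (*-nonneg (0≤n·1 d) 0≤h) i) (0≤q^′ n)) (q^-decay 0<q q<1 (n ℕ.* n) i))))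
      where
      h = 1# - q
      z = ratio (suc b) q n
      p = q ^ 2
      m = n ℕ.+ n ℕ.+ suc (suc b) ℕ.+ 2 ℕ.* K
      X = 1# - z * p ^ K

      0≤q^′ = 0≤q^ 0<q q<1
      0≤h = 0≤1-q 0<q q<1
      0≤p = 0≤q^′ 2
      p≤1 = ^-≤-1 0<q q<1 2
      0≤z = 0≤q^′ (n ℕ.+ n ℕ.+ suc (suc b))
      z≤1 = ^-≤-1 0<q q<1 (n ℕ.+ n ℕ.+ suc (suc b))

      0≤X : 0# ≤ X
      0≤X = ≤-trans (≤⇒0≤ z≤1) (1-zp^-mono 0≤p p≤1 K 0≤z)

      X≤ : X ≤ ι m * h
      X≤ = ≤-resp (+-congˡ (-‿cong (trans (^-homo-* q (n ℕ.+ n ℕ.+ suc (suc b)) (2 ℕ.* K)) (*-congˡ (sym (^-assocʳ q 2 K))))))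
        refl (1-q^≤ 0<q q<1 m)

      m≤ : m ℕ.≤ k ℕ.* suc n
      m≤ = ≡.subst₂ ℕ._≤_ (eq₀ n b K) (eq₀′ n b K) (ℕ.m≤m+n _ ((b ℕ.+ 2 ℕ.* K) ℕ.* n))
        where
        eq₀ : ∀ n b K → (2 ℕ.+ b ℕ.+ 2 ℕ.* K) ℕ.+ 2 ℕ.* n ≡ n ℕ.+ n ℕ.+ suc (suc b) ℕ.+ 2 ℕ.* K
        eq₀ = solve-∀
        eq₀′ : ∀ n b K → (2 ℕ.+ b ℕ.+ 2 ℕ.* K) ℕ.+ 2 ℕ.* n ℕ.+ (b ℕ.+ 2 ℕ.* K) ℕ.* n ≡ (2 ℕ.+ b ℕ.+ 2 ℕ.* K) ℕ.* suc n
        eq₀′ = solve-∀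

      [1+n]²≤ : ∀ n → suc n ℕ.* suc n ℕ.≤ 2 ℕ.* suc (n ℕ.* n)
      [1+n]²≤ zero    = ℕ.s≤s ℕ.z≤n
      [1+n]²≤ (suc n) = ≡.subst (suc (suc n) ℕ.* suc (suc n) ℕ.≤_) (eq₀ n) (ℕ.m≤m+n _ (n ℕ.* n))
        where
        eq₀ : ∀ n → suc (suc n) ℕ.* suc (suc n) ℕ.+ n ℕ.* n ≡ 2 ℕ.* suc (suc n ℕ.* suc n)
        eq₀ = solve-∀

      m²≤ : m ℕ.* m ℕ.≤ d ℕ.* suc (n ℕ.* n)
      m²≤ = ℕ.≤-trans (ℕ.*-mono-≤ m≤ m≤) (≡.subst₂ ℕ._≤_ (eq₀ k n) (eq₀′ k n) (ℕ.*-monoʳ-≤ (k ℕ.* k) ([1+n]²≤ n)))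
        where
        eq₀ : ∀ k n → k ℕ.* k ℕ.* (suc n ℕ.* suc n) ≡ k ℕ.* suc n ℕ.* (k ℕ.* suc n)
        eq₀ = solve-∀
        eq₀′ : ∀ k n → k ℕ.* k ℕ.* (2 ℕ.* suc (n ℕ.* n)) ≡ k ℕ.* k ℕ.* 2 ℕ.* suc (n ℕ.* n)
        eq₀′ = solve-∀

      X²≤ : X ^ 2 ≤ ι d * h * (ι (suc (n ℕ.* n)) * h)
      X²≤ = ≤-trans (^-mono-≤ 0≤X X≤ 2) (≤-resp
        (trans (*-congʳ (ι-* m m)) (solve 2 (λ i h → i :* i :* (h :* h) := i :* h :* (i :* h :* :1)) refl (ι m) h))
        (trans (*-congʳ (ι-* d (suc (n ℕ.* n)))) (solve 3 (λ i j h → i :* j :* (h :* h) := i :* h :* (j :* h)) refl (ι d) (ι (suc (n ℕ.* n))) h))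
        (*-mono-≤ (0≤n·1 (m ℕ.* m)) (*-nonneg 0≤h 0≤h) (ι-mono m²≤) ≤-refl))

      G≤ : g (suc b) q n ≤ q ^ (n ℕ.* n) * q ^ n
      G≤ = ≤-resp refl (^-homo-* q (n ℕ.* n) n)
        (^-antitone 0<q q<1 (ℕ.+-monoʳ-≤ (n ℕ.* n) (ℕ.m≤m+n n (b ℕ.* n))))

      A = (ι d * h) ^ i
      B = (ι (suc (n ℕ.* n)) * h) ^ i

      eq₁ : A * q ^ n * (q ^ (n ℕ.* n) * B) ≈ q ^ (n ℕ.* n) * q ^ n * (A * B)
      eq₁ = solve 4 (λ A B Q R → A :* Q :* (R :* B) := R :* Q :* (A :* B)) refl A B (q ^ n) (q ^ (n ℕ.* n))

      eq₂ : A * q ^ n * ι i ^ i ≈ ι d ^ i * ι i ^ i * h ^ i * q ^ n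
      eq₂ = trans (*-congʳ (*-congʳ (^-distrib-* (ι d) h i)))
        (solve 4 (λ D H Q I → D :* H :* Q :* I := D :* I :* H :* Q) refl (ι d ^ i) (h ^ i) (q ^ n) (ι i ^ i))

  -- Induction on M by `∇u-suc`. The first summand keeps M + K. The second lowers it by 2, which
  -- costs one in i, but its coefficient 1 - (q²)ᴷ is O(1 - q) and returns that power.
  ∇^u-bound : ∀ b M K i → 2 ℕ.* i ℕ.≤ M ℕ.+ K → UniformBound (λ q → ∇^ M (u (suc b) q K)) i
  ∇^u-bound b zero    K i 2i≤ = u-bound b K i 2i≤
  ∇^u-bound b (suc M) zero i 2i≤
    with ∇^u-bound b M 1 i (ℕ.≤-trans 2i≤ (ℕ.≤-reflexive (≡.sym (ℕ.+-suc M 0))))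
  ... | C , 0≤C , p = C , 0≤C , λ 0<q q<1 n →
    ≼-resp (sym (∇^-cong M (∇u-zero (suc b) _) n)) refl (p 0<q q<1 n)
  ∇^u-bound b (suc M) (suc K) i 2i≤
    with ∇^u-bound b M (2 ℕ.+ K) i (ℕ.≤-trans 2i≤ (ℕ.≤-reflexive (≡.sym (ℕ.+-suc M (suc K)))))
       | rest i 2i≤
    where
    0≤coeff : ∀ {q} → 0# < q → q < 1# → 0# ≤ 1# - (q ^ 2) ^ suc K
    0≤coeff {q} 0<q q<1 = ≤⇒0≤ (≤-resp refl (1^n≈1 (suc K))
      (^-mono-≤ (0≤q^ 0<q q<1 2) (^-≤-1 0<q q<1 2) (suc K)))

    rest : ∀ i → 2 ℕ.* i ℕ.≤ suc M ℕ.+ suc K →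
      UniformBound (λ q n → (1# - (q ^ 2) ^ suc K) * ∇^ M (u (suc b) q K) (suc n)) i
    -- No power of 1 - q is to be gained here, so the coefficient is merely bounded by 1.
    rest zero 2i≤ with ∇^u-bound b M K 0 ℕ.z≤n
    ... | C , 0≤C , p = C , 0≤C , λ {q} 0<q q<1 n →
      ≼-weaken (≼-scale (0≤coeff 0<q q<1) (p 0<q q<1 (suc n))) (≤-resp refl (*-identityˡ _)
        (*-mono-≤ (0≤coeff 0<q q<1) (*-nonneg (*-nonneg 0≤C 0≤1) (0≤q^ 0<q q<1 (suc n)))
          (≤-resp refl (x-0≈x 1#) (+-monoʳ-≤ 1# (neg-anti-≤ (^-nonneg (0≤q^ 0<q q<1 2) (suc K)))))
          (*-monoʳ-≤ (*-nonneg 0≤C 0≤1) (^-antitone 0<q q<1 (ℕ.n≤1+n n)))))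
    rest (suc i) 2i≤ with ∇^u-bound b M K i (ℕ.+-cancelˡ-≤ 2 _ _
        (≡.subst₂ ℕ._≤_ (ℕ.*-suc 2 i) (≡.cong suc (ℕ.+-suc M K)) 2i≤))
    ... | C , 0≤C , p = ι (2 ℕ.* suc K) * C , *-nonneg (0≤n·1 (2 ℕ.* suc K)) 0≤C , λ {q} 0<q q<1 n →
      let 0≤Ch = *-nonneg 0≤C (^-nonneg (0≤1-q 0<q q<1) i) in
      ≼-weaken (≼-scale (0≤coeff 0<q q<1) (p 0<q q<1 (suc n))) (≤-resp refl
        (solve 5 (λ k h C H Q → k :* h :* (C :* H :* Q) := k :* C :* (h :* H) :* Q)
          refl (ι (2 ℕ.* suc K)) (1# - q) C ((1# - q) ^ i) (q ^ n))
        (*-mono-≤ (0≤coeff 0<q q<1) (*-nonneg 0≤Ch (0≤q^ 0<q q<1 (suc n)))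
          (≤-resp (+-congˡ (-‿cong (sym (^-assocʳ q 2 (suc K))))) refl (1-q^≤ 0<q q<1 (2 ℕ.* suc K)))
          (*-monoʳ-≤ 0≤Ch (^-antitone 0<q q<1 (ℕ.n≤1+n n)))))
  ... | C , 0≤C , p | C′ , 0≤C′ , p′ = C + C′ , +-nonneg 0≤C 0≤C′ , λ {q} 0<q q<1 n →
    ≼-resp (sym (trans (∇^-cong M (∇u-suc (suc b) q K) n)
                (trans (∇^-lin M 1# _ (u (suc b) q (2 ℕ.+ K)) (u (suc b) q K ∘ suc) n)
                (trans (+-congˡ (*-congˡ (∇^-shift M (u (suc b) q K) n)))
                (solve 3 (λ x c y → :1 :* x :+ (:- c) :* y := x :- c :* y) refl
                  (∇^ M (u (suc b) q (2 ℕ.+ K)) n) (1# - (q ^ 2) ^ suc K) (∇^ M (u (suc b) q K) (suc n)))))))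
           (solve 4 (λ C C′ H Q → C :* H :* Q :+ C′ :* H :* Q := (C :+ C′) :* H :* Q)
             refl C C′ ((1# - q) ^ i) (q ^ n))
           (≼-- (p 0<q q<1 n) (p′ 0<q q<1 n))

  ∇^g-bound : ∀ b M i → 2 ℕ.* i ℕ.≤ M → UniformBound (λ q → ∇^ M (g (suc b) q)) i
  ∇^g-bound b M i 2i≤M with ∇^u-bound b M 0 i (ℕ.≤-trans 2i≤M (ℕ.m≤m+n M 0))
  ... | C , 0≤C , p = C , 0≤C , λ 0<q q<1 n →
    ≼-resp (∇^-cong M (λ n → *-identityʳ _) n) refl (p 0<q q<1 n)

  ∇^g-bounds : ∀ b M → ∃[ Z ] (0# ≤ Z) × (∀ {q} → 0# < q → q < 1# →
    ∀ k n → k ℕ.< M → ∇^ k (g (suc b) q) n ≼ Z * q ^ n)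
  ∇^g-bounds b zero    = 0# , ≤-refl , λ 0<q q<1 k n ()
  ∇^g-bounds b (suc M) with ∇^g-bounds b M | ∇^g-bound b M 0 ℕ.z≤n
  ... | Z , 0≤Z , p | C , 0≤C , p′ = Z + C , +-nonneg 0≤Z 0≤C , bound
    where
    bound : ∀ {q} → 0# < q → q < 1# → ∀ k n → k ℕ.< suc M → ∇^ k (g (suc b) q) n ≼ (Z + C) * q ^ n
    bound {q} 0<q q<1 k n k<1+M with ℕ.m≤n⇒m<n∨m≡n (ℕ.s≤s⁻¹ k<1+M)
    ... | inj₁ k<M = ≼-weaken (p 0<q q<1 k n k<M) (≤-resp (+-identityʳ _) (sym (distribʳ _ _ _))
            (+-monoʳ-≤ (Z * q ^ n) (*-nonneg 0≤C (0≤q^ 0<q q<1 n))))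
    ... | inj₂ ≡.refl = ≼-weaken (p′ 0<q q<1 n)
            (≤-resp (trans (+-identityˡ _) (*-congʳ (sym (*-identityʳ C)))) (sym (distribʳ _ _ _))
            (+-mono-≤ (*-nonneg 0≤Z (0≤q^ 0<q q<1 n)) ≤-refl))

  -- As ≤ is the negation of the reversed <, it suffices to refute y < x, with ε chosen so that D ε
  -- is half the gap.
  ≤-by-approximation : ∀ {x y D} → 0# < D → (∀ ε → 0# < ε → x ≤ y + D * ε) → x ≤ y
  ≤-by-approximation {x} {y} {D} 0<D p y<x = p ε (*-pos (inv-pos D 0<D) 0<½δ)
      (<-resp (+-congˡ (sym Dε)) eq (<-resp (+-identityʳ _) refl (+-monoʳ-< (y + ½ * δ) 0<½δ)))
    where
    δ = x - y
    0<½δ = *-pos (inv-pos _ 0<2) (x<y⇒0<y-x y<x)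
    ε = inv D 0<D * (½ * δ)

    Dε : D * ε ≈ ½ * δ
    Dε = trans (sym (*-assoc _ _ _)) (trans (*-congʳ (inv-inverseʳ D 0<D)) (*-identityˡ _))

    eq : y + ½ * δ + ½ * δ ≈ x
    eq = trans (+-assoc _ _ _) (trans (+-congˡ (½+½ δ)) (trans (+-comm _ _) (x-y+y x y)))

  ≼-by-approximation : ∀ {x y D} → 0# < D → (∀ ε → 0# < ε → x ≼ y + D * ε) → x ≼ y
  ≼-by-approximation 0<D p =
    ≤-by-approximation 0<D (λ ε 0<ε → proj₁ (p ε 0<ε)) , ≤-by-approximation 0<D (λ ε 0<ε → proj₂ (p ε 0<ε))

  -- Let J grow: the partial sums approach ℓ and Z qᴶ vanishes, the two errors together being at
  -- most D ε.
  limit-bound : ∀ {q s ℓ A Y Z} → 0# < q → q < 1# → s ConvergesTo ℓ → 0# ≤ Z →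
    (∀ J → (1# + 1#) * s J - A ≼ (1# + 1#) * (Y + Z * q ^ J)) → (1# + 1#) * ℓ - A ≼ (1# + 1#) * Y
  limit-bound {q} {s} {ℓ} {A} {Y} {Z} 0<q q<1 s→ℓ 0≤Z p = ≼-by-approximation 0<D approx
    where
    D = (1# + 1#) * (1# + Z)

    0<D : 0# < D
    0<D = *-pos 0<2 (<-≤-trans 0<1 (≤-resp (+-identityʳ 1#) refl (+-monoʳ-≤ 1# 0≤Z)))

    approx : ∀ ε → 0# < ε → (1# + 1#) * ℓ - A ≼ (1# + 1#) * Y + D * ε
    approx ε 0<ε = ≼-weaken
        (≼-resp (solve 3 (λ s l A → :2 :* s :- A :- :2 :* (s :- l) := :2 :* l :- A) refl (s J) ℓ A)
          refl (≼-- (p J) (≼-scale (<⇒≤ 0<2) near)))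
        (≤-resp refl (solve 3 (λ Y Z ε → :2 :* (Y :+ Z :* ε) :+ :2 :* ε := :2 :* Y :+ :2 :* (:1 :+ Z) :* ε) refl Y Z ε)
          (+-mono-≤ (*-monoˡ-≤ 0<2 (+-monoʳ-≤ Y (*-monoʳ-≤ 0≤Z q^J≤ε))) ≤-refl))
      where
      N     = proj₁ (s→ℓ ε 0<ε)
      close = proj₂ (s→ℓ ε 0<ε)
      N′    = proj₁ (^-small 0<q q<1 ε 0<ε)
      J     = N ℕ.+ N′

      near : s J - ℓ ≼ ε
      near = <⇒≤ (proj₁ (close J (ℕ.m≤m+n N N′))) ,
        ≤-resp (sym (-[x-y] (s J) ℓ)) refl (<⇒≤ (proj₂ (close J (ℕ.m≤m+n N N′))))

      q^J≤ε : q ^ J ≤ ε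
      q^J≤ε = ≤-trans (^-antitone 0<q q<1 (ℕ.m≤n+m N′ N)) (<⇒≤ (proj₂ (^-small 0<q q<1 ε 0<ε)))

  -- Order M ≥ 2 (i + 1) yields i + 1 powers of 1 - q in the last difference; one of them is spent
  -- on summing qⁿ.
  theta-Euler : ∀ b M i → 2 ℕ.* suc i ℕ.≤ M → ∃[ C ] (0# ≤ C) ×
    (∀ {q} (0<q : 0# < q) (q<1 : q < 1#) →
      (1# + 1#) * ∑∞ (thetaTerm (suc b) q) (thetaTerm-cauchy (suc b) 0<q q<1) - L M (g (suc b) q)
        ≼ (1# + 1#) * (C * (1# - q) ^ i))
  theta-Euler b M i 2i≤M = C , 0≤C , λ {q} 0<q q<1 →
    limit-bound 0<q q<1 (proj₂ (complete _ (thetaTerm-cauchy (suc b) 0<q q<1))) 0≤Z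
      (Euler-bound 0<q q<1 M (C * (1# - q) ^ i) Z (g (suc b) q)
        (*-nonneg 0≤C (^-nonneg (0≤1-q 0<q q<1) i)) 0≤Z (proj₂ (proj₂ bounds) 0<q q<1)
        (λ n → ≼-resp refl
          (*-congʳ (solve 3 (λ C h H → C :* (h :* H) := C :* H :* h) refl C (1# - q) ((1# - q) ^ i)))
          (proj₂ (proj₂ bound) 0<q q<1 n)))
    where
    bound  = ∇^g-bound b M (suc i) 2i≤M
    bounds = ∇^g-bounds b M
    C   = proj₁ bound
    0≤C = proj₁ (proj₂ bound)
    Z   = proj₁ bounds
    0≤Z = proj₁ (proj₂ bounds)

-- Taylor coefficients in t, and polynomial sequences.

module Taylor {c ℓ₁ ℓ₂} (ℝ : RealField c ℓ₁ ℓ₂) where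
  open Ordered ℝ
  open Analysis ℝ
  open import Relation.Binary.Reasoning.Setoid setoid

  -- w n e is the coefficient of tⁿ in ((1 - t) / (1 + t))ᵉ.
  w : ℕ → ℕ → Carrier
  w zero    e       = 1#
  w (suc n) zero    = 0#
  w (suc n) (suc e) = w (suc n) e - w n e - w n (suc e)

  w-1 : ∀ e → w 1 e ≈ - ((1# + 1#) * ι e)
  w-1 zero    = solve 0 (:0 := :- (:2 :* :0)) refl
  w-1 (suc e) = trans (+-congʳ (+-congʳ (w-1 e)))
    (solve 1 (λ e → :- (:2 :* e) :- :1 :- :1 := :- (:2 :* (:1 :+ e))) refl (ι e))

  -- The differential equation (1 - t²) W′ = - 2 e W of W = ((1 - t) / (1 + t))ᵉ.
  w-defect : ℕ → ℕ → Carrier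
  w-defect n e = ι (2 ℕ.+ n) * w (2 ℕ.+ n) e + (1# + 1#) * ι e * w (1 ℕ.+ n) e - ι n * w n e

  -- The defect obeys the recurrence that defines `w`, so it vanishes by induction from e = 0; for n
  -- = 0 the closed form `w-1` replaces the terms out of range.
  w-defect≈0 : ∀ n e → w-defect n e ≈ 0#
  w-defect≈0 zero zero =
    solve 0 ((:1 :+ (:1 :+ :0)) :* :0 :+ :2 :* :0 :* :0 :- :0 :* :1 := :0) refl
  w-defect≈0 (suc n) zero =
    solve 2 (λ n m → n :* :0 :+ :2 :* :0 :* :0 :- m :* :0 := :0) refl (ι (3 ℕ.+ n)) (ι (suc n))
  w-defect≈0 zero (suc e) = begin
    w-defect 0 (suc e)
      ≈⟨ solve 3 (λ e w₁ w₂ →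
           (:1 :+ (:1 :+ :0)) :* (w₂ :- w₁ :- (w₁ :- :1 :- :1)) :+ :2 :* (:1 :+ e) :* (w₁ :- :1 :- :1) :- :0 :* :1
             := ((:1 :+ (:1 :+ :0)) :* w₂ :+ :2 :* e :* w₁ :- :0 :* :1) :- :2 :* (w₁ :+ :2 :* e))
           refl (ι e) (w 1 e) (w 2 e) ⟩
    w-defect 0 e - (1# + 1#) * (w 1 e + (1# + 1#) * ι e)
      ≈⟨ +-cong (w-defect≈0 0 e) (-‿cong (*-congˡ (trans (+-congʳ (w-1 e)) (-‿inverseˡ _)))) ⟩
    0# - (1# + 1#) * 0#
      ≈⟨ solve 0 (:0 :- :2 :* :0 := :0) refl ⟩
    0# ∎
  w-defect≈0 (suc n) (suc e) = begin
    w-defect (suc n) (suc e)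
      ≈⟨ solve 7 (λ n e w₀′ w₀ w₁ w₂ w₃ →
           let w₁′ = w₁ :- w₀ :- w₀′
               w₂′ = w₂ :- w₁ :- w₁′
               w₃′ = w₃ :- w₂ :- w₂′ in
           (:1 :+ (:1 :+ (:1 :+ n))) :* w₃′ :+ :2 :* (:1 :+ e) :* w₂′ :- (:1 :+ n) :* w₁′
             := ((:1 :+ (:1 :+ (:1 :+ n))) :* w₃ :+ :2 :* e :* w₂ :- (:1 :+ n) :* w₁)
                 :- ((:1 :+ (:1 :+ n)) :* w₂ :+ :2 :* e :* w₁ :- n :* w₀)
                 :- ((:1 :+ (:1 :+ n)) :* w₂′ :+ :2 :* (:1 :+ e) :* w₁′ :- n :* w₀′))
           refl (ι n) (ι e) (w n (suc e)) (w n e) (w (1 ℕ.+ n) e) (w (2 ℕ.+ n) e) (w (3 ℕ.+ n) e) ⟩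
    w-defect (suc n) e - w-defect n e - w-defect n (suc e)
      ≈⟨ +-cong (+-cong (w-defect≈0 (suc n) e) (-‿cong (w-defect≈0 n e))) (-‿cong (w-defect≈0 n (suc e))) ⟩
    0# - 0# - 0#
      ≈⟨ solve 0 (:0 :- :0 :- :0 := :0) refl ⟩
    0# ∎

  w-rec : ∀ n e → ι (2 ℕ.+ n) * w (2 ℕ.+ n) e ≈ ι n * w n e - (1# + 1#) * ι e * w (1 ℕ.+ n) e
  w-rec n e = begin
    ι (2 ℕ.+ n) * w (2 ℕ.+ n) e
      ≈⟨ solve 3 (λ a b c → a := (a :+ b :- c) :+ (c :- b)) refl
           (ι (2 ℕ.+ n) * w (2 ℕ.+ n) e) ((1# + 1#) * ι e * w (1 ℕ.+ n) e) (ι n * w n e) ⟩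
    w-defect n e + (ι n * w n e - (1# + 1#) * ι e * w (1 ℕ.+ n) e)
      ≈⟨ trans (+-congʳ (w-defect≈0 n e)) (+-identityˡ _) ⟩
    ι n * w n e - (1# + 1#) * ι e * w (1 ℕ.+ n) e ∎

  -- Polynomial sequences of degree below d, encoded by the vanishing of the d-th difference.
  Deg< : ℕ → (ℕ → Carrier) → Set _
  Deg< d v = ∀ n → ∇^ d v n ≈ 0#

  Deg<-cong : ∀ d {v v′} → (∀ n → v n ≈ v′ n) → Deg< d v → Deg< d v′
  Deg<-cong d v≈v′ p n = trans (sym (∇^-cong d v≈v′ n)) (p n)

  Deg<-lin : ∀ d a b {v v′} → Deg< d v → Deg< d v′ → Deg< d (λ n → a * v n + b * v′ n)
  Deg<-lin d a b {v} {v′} p p′ n = trans (∇^-lin d a b v v′ n)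
    (trans (+-cong (*-congˡ (p n)) (*-congˡ (p′ n)))
      (solve 2 (λ a b → a :* :0 :+ b :* :0 := :0) refl a b))

  Deg<-shift : ∀ d {v} → Deg< d v → Deg< d (v ∘ suc)
  Deg<-shift d {v} p n = trans (∇^-shift d v n) (p (suc n))

  Deg<-suc : ∀ d {v} → Deg< d v → Deg< (suc d) v
  Deg<-suc d {v} p = Deg<-cong d
    (λ n → solve 2 (λ x y → :1 :* x :+ :- :1 :* y := x :- y) refl (v n) (v (suc n)))
    (Deg<-lin d 1# (- 1#) p (Deg<-shift d p))

  -- Product rule: the difference of n v (n) is n ∇ v (n) - v (n + 1).
  Deg<-×ι : ∀ d {v} → Deg< d v → Deg< (suc d) (λ n → ι n * v n)
  Deg<-×ι zero {v} p n = trans (+-cong (*-congˡ (p n)) (-‿cong (*-congˡ (p (suc n)))))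
    (solve 2 (λ a b → a :* :0 :- b :* :0 := :0) refl (ι n) (ι (suc n)))
  Deg<-×ι (suc d) {v} p = Deg<-cong (suc d)
    (λ n → solve 3 (λ i x y → :1 :* (i :* (x :- y)) :+ :- :1 :* y := i :* x :- (:1 :+ i) :* y)
      refl (ι n) (v n) (v (suc n)))
    (Deg<-lin (suc d) 1# (- 1#) (Deg<-×ι d p) (Deg<-shift (suc d) {v} p))

  Deg<-cancel : ∀ d k {v} → Deg< d (λ n → ι (suc k) * v n) → Deg< d v
  Deg<-cancel d k {v} p n = *-cancelˡ-≈ (0<ι-suc k) (begin
    ι (suc k) * ∇^ d v n
      ≈⟨ solve 2 (λ a x → a :* x := a :* x :+ :0 :* x) refl (ι (suc k)) (∇^ d v n) ⟩
    ι (suc k) * ∇^ d v n + 0# * ∇^ d v n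
      ≈⟨ ∇^-lin d (ι (suc k)) 0# v v n ⟨
    ∇^ d (λ n → ι (suc k) * v n + 0# * v n) n
      ≈⟨ ∇^-cong d (λ n → solve 2 (λ a x → a :* x :+ :0 :* x := a :* x) refl (ι (suc k)) (v n)) n ⟩
    ∇^ d (λ n → ι (suc k) * v n) n
      ≈⟨ p n ⟩
    0#
      ≈⟨ zeroʳ _ ⟨
    ι (suc k) * 0# ∎)

  ι-e : ∀ b i n → ι (i ℕ.+ e b n) ≈ ι i + (ι n * ι n + ι b * ι n)
  ι-e b i n = trans (ι-+ i (e b n))
    (+-congˡ (trans (ι-+ (n ℕ.* n) (b ℕ.* n)) (+-cong (ι-* n n) (ι-* b n))))

  Deg<-×e : ∀ b i d {v} → Deg< d v → Deg< (2 ℕ.+ d) (λ n → ι (i ℕ.+ e b n) * v n)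
  Deg<-×e b i d {v} p = Deg<-cong (2 ℕ.+ d) eq
    (Deg<-lin (2 ℕ.+ d) 1# (ι i)
      (Deg<-×ι (suc d) (Deg<-lin (suc d) 1# (ι b) (Deg<-×ι d p) (Deg<-suc d p)))
      (Deg<-suc (suc d) {v} (Deg<-suc d p)))
    where
    eq : ∀ n → 1# * (ι n * (1# * (ι n * v n) + ι b * v n)) + ι i * v n ≈ ι (i ℕ.+ e b n) * v n
    eq n = trans
      (solve 4 (λ x b i v → :1 :* (x :* (:1 :* (x :* v) :+ b :* v)) :+ i :* v := (i :+ (x :* x :+ b :* x)) :* v)
        refl (ι n) (ι b) (ι i) (v n))
      (*-congʳ (sym (ι-e b i n)))

  -- By `w-rec`, `w n` is a polynomial of degree at most n in the exponent, which is quadratic in x.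
  -- `Deg<-cancel` removes the factor n + 2 of the recurrence.
  Deg<-w : ∀ b i n → Deg< (suc (dbl n)) (λ x → w n (i ℕ.+ e b x))
  Deg<-w b i zero n = -‿inverseʳ 1#
  Deg<-w b i (suc zero) = Deg<-cong 3
    (λ x → trans (solve 1 (λ x → :- :2 :* (x :* :1) :+ :0 :* (x :* :1) := :- (:2 :* x)) refl (ι (i ℕ.+ e b x)))
      (sym (w-1 (i ℕ.+ e b x))))
    (Deg<-lin 3 (- (1# + 1#)) 0# one one)
    where
    one = Deg<-×e b i 1 {λ _ → 1#} (λ _ → -‿inverseʳ 1#)
  Deg<-w b i (suc (suc n)) = Deg<-cancel (5 ℕ.+ dbl n) (suc n) (Deg<-cong (5 ℕ.+ dbl n)
    (λ x → trans (solve 4 (λ n w₀ E w₁ → n :* w₀ :+ :- :2 :* (E :* w₁) := n :* w₀ :- :2 :* E :* w₁)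
                   refl (ι n) (w n (E x)) (ι (E x)) (w (suc n) (E x)))
             (sym (w-rec n (E x))))
    (Deg<-lin (5 ℕ.+ dbl n) (ι n) (- (1# + 1#))
      (raise (3 ℕ.+ dbl n) (raise (suc (dbl n)) (Deg<-w b i n))) (Deg<-×e b i (3 ℕ.+ dbl n) (Deg<-w b i (suc n)))))
    where
    E : ℕ → ℕ
    E x = i ℕ.+ e b x

    raise : ∀ d → Deg< d (w n ∘ E) → Deg< (2 ℕ.+ d) (w n ∘ E)
    raise d p = Deg<-suc (suc d) {w n ∘ E} (Deg<-suc d p)

  -- Every further term of Euler's sum contains a difference of order at least d, so truncation at d
  -- is exact.
  L-Deg< : ∀ d k v → Deg< d v → L (d ℕ.+ k) v ≈ L d v
  L-Deg< zero    zero    v p = refl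
  L-Deg< zero    (suc k) v p = trans
    (+-cong (p 0) (*-congˡ (L-Deg< 0 k (∇ v) (λ n → Deg<-suc 0 {v} p n))))
    (solve 1 (λ h → :0 :+ h :* :0 := :0) refl ½)
  L-Deg< (suc d) k v p = +-congˡ (*-congˡ (L-Deg< d k (∇ v) p))

  -- The formal coefficients of qⁱ f b = 2 ∑ (-1)ˣ q^(i + e b x).
  coeff : ℕ → ℕ → ℕ → Carrier
  coeff b i n = L (suc (dbl n)) (λ x → w n (i ℕ.+ e b x))

  coeff-L : ∀ b i {n M} → suc (dbl n) ℕ.≤ M → L M (λ x → w n (i ℕ.+ e b x)) ≈ coeff b i n
  coeff-L b i {n} {M} n<M = trans
    (reflexive (≡.cong (λ k → L k (λ x → w n (i ℕ.+ e b x))) (≡.sym (ℕ.m+[n∸m]≡n n<M))))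
    (L-Deg< (suc (dbl n)) (M ℕ.∸ suc (dbl n)) _ (Deg<-w b i n))

-- Uniqueness and existence of the asymptotic expansion.

module Asymptotics {c ℓ₁ ℓ₂} (ℝ : RealField c ℓ₁ ℓ₂) where
  open Ordered ℝ
  open Analysis ℝ
  open Euler ℝ
  open Taylor ℝ
  open import Relation.Binary.Reasoning.Setoid setoid

  ∑-cong-< : ∀ N (u v : ℕ → Carrier) → (∀ n → n ℕ.< N → u n ≈ v n) → ∑< N u ≈ ∑< N v
  ∑-cong-< zero    u v p = refl
  ∑-cong-< (suc N) u v p =
    +-cong (p 0 (ℕ.s≤s ℕ.z≤n)) (∑-cong-< N (u ∘ suc) (v ∘ suc) (λ n n<N → p (suc n) (ℕ.s≤s n<N)))

  magnitude : ∀ x → ∃[ B ] (0# < B × x ≼ B)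
  magnitude x = ι (suc k) , 0<ι-suc k ,
    ≤-trans (<⇒≤ (proj₂ (archimedean x))) (ι-mono (ℕ.≤-trans (ℕ.m≤m+n m n) (ℕ.n≤1+n k))) ,
    ≤-trans (<⇒≤ (proj₂ (archimedean (- x)))) (ι-mono (ℕ.≤-trans (ℕ.m≤n+m n m) (ℕ.n≤1+n k)))
    where
    m = proj₁ (archimedean x)
    n = proj₁ (archimedean (- x))
    k = m ℕ.+ n

  ≼-cancel : ∀ {x y z} → 0# < z → z * x ≼ z * y → x ≼ y
  ≼-cancel {x} {y} {z} 0<z (p , p′) = *-cancelˡ-≤ 0<z p , *-cancelˡ-≤ 0<z
    (≤-resp (solve 2 (λ z x → :- (z :* x) := z :* :- x) refl z x) refl p′)

  -- If the coefficients below N agree, the truncations of order N differ by exactly d tᴺ with d = a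
  -- N - a′ N, while both lie within O(tᴺ⁺¹) of F. So |d| ≤ B t for all small t, which forces d = 0.
  ∼-unique : ∀ {F a a′} → F ∼ a → F ∼ a′ → ∀ n → a n ≈ a′ n
  ∼-unique {F} {a} {a′} F∼a F∼a′ n = agree (suc n) n (ℕ.n<1+n n)
    where
    term : (ℕ → Carrier) → Carrier → ℕ → Carrier
    term a t n = a n * t ^ n

    next : ∀ N → (∀ n → n ℕ.< N → a n ≈ a′ n) → a N ≈ a′ N
    next N IH = trans (sym (x-y+y (a N) (a′ N))) (trans (+-congʳ d≈0) (+-identityˡ _))
      where
      d  = a N - a′ N
      C  = proj₁ (F∼a N)
      C′ = proj₁ (F∼a′ N)
      δ  = proj₁ (proj₂ (F∼a N))
      δ′ = proj₁ (proj₂ (F∼a′ N))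
      0<δ  = proj₁ (proj₂ (proj₂ (F∼a N)))
      0<δ′ = proj₁ (proj₂ (proj₂ (F∼a′ N)))
      B   = proj₁ (magnitude (C + C′))
      0<B = proj₁ (proj₂ (magnitude (C + C′)))
      C≤B = proj₁ (proj₂ (proj₂ (magnitude (C + C′))))

      small : ∀ t (0<t : 0# < t) (t<1 : t < 1#) → t < δ → t < δ′ → d ≼ B * t
      small t 0<t t<1 t<δ t<δ′ = ≼-weaken (≼-cancel (^-pos 0<t N) (≼-resp eq
          (solve 4 (λ C C′ t Q → C :* (t :* Q) :+ C′ :* (t :* Q) := Q :* ((C :+ C′) :* t)) refl C C′ t (t ^ N))
          (≼-- (proj₂ bound , ≤-resp (sym (-[x-y] S₁ Φ)) refl (proj₁ bound))
               (proj₂ bound′ , ≤-resp (sym (-[x-y] S₂ Φ)) refl (proj₁ bound′)))))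
        (≤-resp (*-comm _ _) (*-comm _ _) (*-monoˡ-≤ 0<t C≤B))
        where
        Φ  = F t 0<t t<1
        S₁ = ∑< (suc N) (term a t)
        S₂ = ∑< (suc N) (term a′ t)
        bound  = proj₂ (proj₂ (proj₂ (F∼a N))) t 0<t t<1 t<δ
        bound′ = proj₂ (proj₂ (proj₂ (F∼a′ N))) t 0<t t<1 t<δ′

        eq : (S₁ - Φ) - (S₂ - Φ) ≈ t ^ N * d
        eq = begin
          (S₁ - Φ) - (S₂ - Φ)
            ≈⟨ solve 3 (λ x y z → (x :- z) :- (y :- z) := x :- y) refl S₁ S₂ Φ ⟩
          S₁ - S₂
            ≈⟨ +-cong (∑-snoc (term a t) N) (-‿cong (trans (∑-snoc (term a′ t) N)
                 (+-congʳ (sym (∑-cong-< N (term a t) (term a′ t) (λ n n<N → *-congʳ (IH n n<N))))))) ⟩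
          (S + a N * t ^ N) - (S + a′ N * t ^ N)
            ≈⟨ solve 4 (λ S x y Q → (S :+ x :* Q) :- (S :+ y :* Q) := Q :* (x :- y)) refl S (a N) (a′ N) (t ^ N) ⟩
          t ^ N * d ∎
          where
          S = ∑< N (term a t)

      d≼0 : d ≼ 0#
      d≼0 = ≼-by-approximation 0<B λ ε 0<ε →
        -- Three uses of `below` make t smaller than δ, δ′, 1 and ε at once.
        let x , 0<x , x<δ , x<δ′ = below δ δ′ 0<δ 0<δ′
            y , 0<y , y<1 , y<ε  = below 1# ε 0<1 0<ε
            t , 0<t , t<x , t<y  = below x y 0<x 0<y in
        ≼-weaken
          (small t 0<t (<-≤-trans t<y (<⇒≤ y<1)) (<-≤-trans t<x (<⇒≤ x<δ)) (<-≤-trans t<x (<⇒≤ x<δ′)))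
          (≤-resp refl (sym (+-identityˡ _)) (*-monoˡ-≤ 0<B (≤-trans (<⇒≤ t<y) (<⇒≤ y<ε))))

      d≈0 : d ≈ 0#
      d≈0 = ≤-antisym (proj₁ d≼0) (≤-resp refl (-‿involutive d)
        (≤-resp -0#≈0# refl (neg-anti-≤ (proj₂ d≼0))))

    agree : ∀ N n → n ℕ.< N → a n ≈ a′ n
    agree (suc N) n n<1+N with ℕ.m≤n⇒m<n∨m≡n (ℕ.s≤s⁻¹ n<1+N)
    ... | inj₁ n<N    = agree N n n<N
    ... | inj₂ ≡.refl = next N (agree N)

  partial : ℕ → Carrier → ℕ → Carrier
  partial N t e = ∑< (suc N) (λ n → w n e * t ^ n)

  partial-zero : ∀ N t → partial N t 0 ≈ 1#
  partial-zero zero    t = solve 0 (:1 :* :1 :+ :0 := :1) refl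
  partial-zero (suc N) t = trans (∑-snoc (λ n → w n 0 * t ^ n) (suc N))
    (trans (+-congʳ (partial-zero N t)) (solve 1 (λ Q → :1 :+ :0 :* Q := :1) refl (t ^ suc N)))

  -- The relation (1 - t) qᵉ = (1 + t) qᵉ⁺¹ survives truncation up to one term of degree N + 1.
  partial-suc : ∀ N t e → (1# - t) * partial N t e - (1# + t) * partial N t (suc e)
    ≈ - ((w N e + w N (suc e)) * t ^ suc N)
  partial-suc zero    t e = solve 1 (λ t →
      (:1 :- t) :* (:1 :* :1 :+ :0) :- (:1 :+ t) :* (:1 :* :1 :+ :0) := :- ((:1 :+ :1) :* (t :* :1))) refl t
  partial-suc (suc N) t e = begin
    (1# - t) * partial (suc N) t e - (1# + t) * partial (suc N) t (suc e)
      ≈⟨ +-cong (*-congˡ (∑-snoc (λ n → w n e * t ^ n) (suc N)))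
                (-‿cong (*-congˡ (∑-snoc (λ n → w n (suc e) * t ^ n) (suc N)))) ⟩
    (1# - t) * (P + x′ * (t * Q)) - (1# + t) * (P′ + (x′ - x - y) * (t * Q))
      ≈⟨ solve 7 (λ t P P′ Q x y x′ →
           (:1 :- t) :* (P :+ x′ :* (t :* Q)) :- (:1 :+ t) :* (P′ :+ (x′ :- x :- y) :* (t :* Q))
             := ((:1 :- t) :* P :- (:1 :+ t) :* P′) :+ ((x :+ y) :* (t :* Q) :- (x′ :+ (x′ :- x :- y)) :* (t :* (t :* Q))))
           refl t P P′ Q x y x′ ⟩
    ((1# - t) * P - (1# + t) * P′) + ((x + y) * (t * Q) - (x′ + (x′ - x - y)) * (t * (t * Q)))
      ≈⟨ +-congʳ (partial-suc N t e) ⟩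
    - ((x + y) * (t * Q)) + ((x + y) * (t * Q) - (x′ + (x′ - x - y)) * (t * (t * Q)))
      ≈⟨ solve 2 (λ a b → :- a :+ (a :- b) := :- b) refl _ _ ⟩
    - ((x′ + (x′ - x - y)) * (t * (t * Q))) ∎
    where
    P  = partial N t e
    P′ = partial N t (suc e)
    Q  = t ^ N
    x  = w N e
    y  = w N (suc e)
    x′ = w (suc N) e

  module _ {q t} (0<t : 0# < t) (t<1 : t < 1#) (q[1+t] : q * (1# + t) ≈ 1# - t) where

    -- By `partial-suc`, 1 + t times the error at e + 1 equals 1 - t times the error at e, up to the
    -- top term; then 1 - t ≤ 1 ≤ 1 + t.
    remainder-suc : ∀ N e {C B} → 0# ≤ C → q ^ e - partial N t e ≼ C * t ^ suc N →
      w N e + w N (suc e) ≼ B → q ^ suc e - partial N t (suc e) ≼ (C + B) * t ^ suc N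
    remainder-suc N e {C} {B} 0≤C p p′ = ≼-cancel (0<1+t 0<t) (≼-weaken (≼-resp eq refl
        (≼-- (≼-scale (≤⇒0≤ (<⇒≤ t<1)) p) (≼-scale (<⇒≤ (^-pos 0<t (suc N))) p′)))
      (≤-trans (≤-resp refl (solve 3 (λ C B Q → C :* Q :+ Q :* B := :1 :* ((C :+ B) :* Q)) refl C B Q)
          (+-mono-≤ (≤-resp refl (*-identityˡ _) (*-mono-≤ (≤⇒0≤ (<⇒≤ t<1)) (*-nonneg 0≤C 0≤Q)
            (≤-resp refl (x-0≈x 1#) (+-monoʳ-≤ 1# (neg-anti-≤ (<⇒≤ 0<t)))) ≤-refl)) ≤-refl))
        (*-mono-≤ 0≤1 (*-nonneg (+-nonneg 0≤C (≼-bound-nonneg p′)) 0≤Q)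
          (≤-resp (+-identityʳ 1#) refl (+-monoʳ-≤ 1# (<⇒≤ 0<t))) ≤-refl)))
      where
      Q = t ^ suc N
      0≤Q = <⇒≤ (^-pos 0<t (suc N))
      P  = partial N t e
      P′ = partial N t (suc e)
      s  = w N e + w N (suc e)

      eq : (1# - t) * (q ^ e - P) - Q * s ≈ (1# + t) * (q ^ suc e - P′)
      eq = begin
        (1# - t) * (q ^ e - P) - Q * s
          ≈⟨ solve 5 (λ t R P Q s → (:1 :- t) :* (R :- P) :- Q :* s := (:1 :- t) :* R :- (:1 :- t) :* P :+ :- (s :* Q))
               refl t (q ^ e) P Q s ⟩
        (1# - t) * q ^ e - (1# - t) * P + - (s * Q)
          ≈⟨ +-cong (+-congʳ (*-congʳ (sym q[1+t]))) (sym (partial-suc N t e)) ⟩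
        q * (1# + t) * q ^ e - (1# - t) * P + ((1# - t) * P - (1# + t) * P′)
          ≈⟨ solve 5 (λ q t R P P′ → q :* (:1 :+ t) :* R :- (:1 :- t) :* P :+ ((:1 :- t) :* P :- (:1 :+ t) :* P′)
               := (:1 :+ t) :* (q :* R :- P′)) refl q t (q ^ e) P P′ ⟩
        (1# + t) * (q ^ suc e - P′) ∎

  RemainderBound : ℕ → ℕ → Carrier → Set _
  RemainderBound N e C = ∀ {q t} → 0# < t → t < 1# → q * (1# + t) ≈ 1# - t →
    q ^ e - partial N t e ≼ C * t ^ suc N

  remainder : ∀ N e → ∃[ C ] (0# ≤ C × RemainderBound N e C)
  remainder N zero    = 0# , ≤-refl , λ {q} {t} 0<t t<1 _ → ≼-resp
    (sym (trans (+-congˡ (-‿cong (partial-zero N t))) (-‿inverseʳ 1#))) (sym (zeroˡ _)) (≼-0 ≤-refl)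
  remainder N (suc e) =
    let C , 0≤C , p  = remainder N e
        B , 0<B , p′ = magnitude (w N e + w N (suc e)) in
    C + B , +-nonneg 0≤C (<⇒≤ 0<B) , λ 0<t t<1 q[1+t] →
      remainder-suc 0<t t<1 q[1+t] N e 0≤C (p 0<t t<1 q[1+t]) p′

  -- The Taylor constants depend on x without uniformity, but `L M` reads only v 0, ..., v (M - 1),
  -- so one C′ serves all v and y.
  L-bound : ∀ M (C : ℕ → Carrier) → ∃[ C′ ] (∀ v y → (∀ x → v x ≼ C x * y) → L M v ≼ C′ * y)
  L-bound zero    C = 0# , λ v y p → ≼-0 (≤-reflexive (sym (zeroˡ y)))
  L-bound (suc M) C =
    let C′ , p = L-bound M (λ x → C x + C (suc x)) in
    C 0 + ½ * C′ , λ v y v≼ → ≼-resp refl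
      (solve 4 (λ C h C′ y → C :* y :+ h :* (C′ :* y) := (C :+ h :* C′) :* y) refl (C 0) ½ C′ y)
      (≼-+ (v≼ 0) (≼-scale 0≤½ (p (∇ v) y λ x →
        ≼-resp refl (sym (distribʳ y (C x) (C (suc x)))) (≼-- (v≼ x) (v≼ (suc x))))))

  L-∑ : ∀ M K (c : ℕ → ℕ → Carrier) (s : ℕ → Carrier) →
    L M (λ x → ∑< K (λ n → c n x * s n)) ≈ ∑< K (λ n → L M (c n) * s n)
  L-∑ M zero    c s = L-zero M
    where
    L-zero : ∀ M → L M (λ _ → 0#) ≈ 0#
    L-zero zero    = refl
    L-zero (suc M) = trans (+-congˡ (*-congˡ (trans (L-cong M (λ _ → -‿inverseʳ 0#)) (L-zero M))))
      (solve 1 (λ h → :0 :+ h :* :0 := :0) refl ½)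
  L-∑ M (suc K) c s = begin
    L M (λ x → c 0 x * s 0 + R x)
      ≈⟨ L-cong M (λ x → solve 3 (λ c s r → c :* s :+ r := s :* c :+ :1 :* r) refl (c 0 x) (s 0) (R x)) ⟩
    L M (λ x → s 0 * c 0 x + 1# * R x)
      ≈⟨ L-lin M (s 0) 1# (c 0) R ⟩
    s 0 * L M (c 0) + 1# * L M R
      ≈⟨ +-cong (*-comm _ _) (trans (*-identityˡ _) (L-∑ M K (c ∘ suc) (s ∘ suc))) ⟩
    L M (c 0) * s 0 + ∑< K (λ n → L M (c (suc n)) * s (suc n)) ∎
    where
    R : ℕ → Carrier
    R x = ∑< K (λ n → c (suc n) x * s (suc n))

  nome-eq : ∀ t 0<t → nome t 0<t * (1# + t) ≈ 1# - t
  nome-eq t 0<t = trans (*-assoc _ _ _) (trans (*-congˡ (inv-inverseˡ _ (0<1+t 0<t))) (*-identityʳ _))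

  1-nome≤2t : ∀ t 0<t → 1# - nome t 0<t ≤ (1# + 1#) * t
  1-nome≤2t t 0<t = ≤-trans
    (≤-resp (*-identityˡ _) refl (*-mono-≤ 0≤1 (<⇒≤ (x<y⇒0<y-x (nome<1 t 0<t)))
      (≤-resp (+-identityʳ 1#) refl (+-monoʳ-≤ 1# (<⇒≤ 0<t))) ≤-refl))
    (≤-reflexive (begin
      (1# + t) * (1# - q)          ≈⟨ solve 2 (λ t q → (:1 :+ t) :* (:1 :- q) := :1 :+ t :- q :* (:1 :+ t)) refl t q ⟩
      1# + t - q * (1# + t)        ≈⟨ +-congˡ (-‿cong (nome-eq t 0<t)) ⟩
      1# + t - (1# - t)            ≈⟨ solve 1 (λ t → :1 :+ t :- (:1 :- t) := :2 :* t) refl t ⟩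
      (1# + 1#) * t                ∎))
    where
    q = nome t 0<t

  -- Two errors are added: the Euler truncation, O((1 - q)ᴺ⁺¹) and hence O(tᴺ⁺¹) by `1-nome≤2t`, and
  -- `L M` of the Taylor remainders. The estimate holds on all of (0,1), so δ = 1.
  f∼coeff : ∀ b → f (suc b) ∼ coeff (suc b) 0
  f∼coeff b N = C , 1# , 0<1 , λ t 0<t t<1 _ →
      let p = bound t 0<t t<1 in proj₁ p , ≤-resp (-[x-y] _ _) refl (proj₂ p)
    where
    -- M = 2 N + 4 is what `theta-Euler` requires for i = N + 1, and it exceeds the degree 2 n of
    -- every coefficient with n ≤ N, as `coeff-L` requires.
    M = dbl (suc (suc N))
    euler = theta-Euler b M (suc N) (ℕ.≤-reflexive (≡.sym (dbl≡2* (suc (suc N)))))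
    C₁   = proj₁ euler
    0≤C₁ = proj₁ (proj₂ euler)
    taylor = L-bound M (λ x → proj₁ (remainder N (e (suc b) x)))
    C₂ = proj₁ taylor
    2^ = (1# + 1#) ^ suc N
    C  = (1# + 1#) * (C₁ * 2^) + C₂

    bound : ∀ t 0<t t<1 →
      f (suc b) t 0<t t<1 - ∑< (suc N) (λ n → coeff (suc b) 0 n * t ^ n) ≼ C * t ^ suc N
    bound t 0<t t<1 = ≼-resp eq
        (solve 4 (λ C₁ C₂ p Q → :2 :* (C₁ :* (p :* Q)) :+ C₂ :* Q := (:2 :* (C₁ :* p) :+ C₂) :* Q) refl C₁ C₂ 2^ (t ^ suc N))
        (≼-+ (≼-weaken (proj₂ (proj₂ euler) (0<nome t 0<t t<1) (nome<1 t 0<t))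
               (*-monoˡ-≤ 0<2 (*-monoʳ-≤ 0≤C₁ (≤-resp refl (^-distrib-* (1# + 1#) t (suc N))
                 (^-mono-≤ (<⇒≤ (x<y⇒0<y-x (nome<1 t 0<t))) (1-nome≤2t t 0<t) (suc N))))))
             (proj₂ taylor (λ x → 1# * q ^ e (suc b) x + - 1# * partial N t (e (suc b) x)) (t ^ suc N)
               (λ x → ≼-resp (solve 2 (λ a b → a :- b := :1 :* a :+ :- :1 :* b) refl (q ^ e (suc b) x) (partial N t (e (suc b) x))) refl
                 (proj₂ (proj₂ (remainder N (e (suc b) x))) 0<t t<1 (nome-eq t 0<t)))))
      where
      q = nome t 0<t
      Φ = f (suc b) t 0<t t<1
      G = L M (g (suc b) q)
      S = ∑< (suc N) (λ n → coeff (suc b) 0 n * t ^ n)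

      LP : L M (λ x → partial N t (e (suc b) x)) ≈ S
      LP = trans (L-∑ M (suc N) (λ n x → w n (e (suc b) x)) (t ^_))
        (∑-cong-< (suc N) _ (λ n → coeff (suc b) 0 n * t ^ n) λ n n<1+N → *-congʳ (coeff-L (suc b) 0
          (ℕ.≤-trans (ℕ.s≤s (dbl-mono (ℕ.s≤s⁻¹ n<1+N))) (ℕ.m≤n+m _ 3))))

      eq : Φ - G + L M (λ x → 1# * q ^ e (suc b) x + - 1# * partial N t (e (suc b) x)) ≈ Φ - S
      eq = begin
        Φ - G + L M (λ x → 1# * q ^ e (suc b) x + - 1# * partial N t (e (suc b) x))
          ≈⟨ +-congˡ (trans (L-lin M 1# (- 1#) (g (suc b) q) _) (+-congˡ (*-congˡ LP))) ⟩
        Φ - G + (1# * G + - 1# * S)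
          ≈⟨ solve 3 (λ Φ G S → Φ :- G :+ (:1 :* G :+ :- :1 :* S) := Φ :- S) refl Φ G S ⟩
        Φ - S ∎

-- Delannoy polynomials and multiplication by - 2 (x² + b x).

module Delannoy {c ℓ₁ ℓ₂} (ℝ : RealField c ℓ₁ ℓ₂) where
  open Ordered ℝ
  open Analysis ℝ
  open Taylor ℝ
  open import Relation.Binary.Reasoning.Setoid setoid

  L-+ : ∀ M v v′ → L M (λ x → v x + v′ x) ≈ L M v + L M v′
  L-+ M v v′ = trans (L-cong M (λ x → solve 2 (λ a b → a :+ b := :1 :* a :+ :1 :* b) refl (v x) (v′ x)))
    (trans (L-lin M 1# 1# v v′) (+-cong (*-identityˡ _) (*-identityˡ _)))

  L-- : ∀ M v v′ → L M (λ x → v x - v′ x) ≈ L M v - L M v′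
  L-- M v v′ = trans (L-cong M (λ x → solve 2 (λ a b → a :- b := :1 :* a :+ :- :1 :* b) refl (v x) (v′ x)))
    (trans (L-lin M 1# (- 1#) v v′) (solve 2 (λ a b → :1 :* a :+ :- :1 :* b := a :- b) refl (L M v) (L M v′)))

  L-* : ∀ M a v → L M (λ x → a * v x) ≈ a * L M v
  L-* M a v = trans (L-cong M (λ x → solve 2 (λ a v → a :* v := a :* v :+ :0 :* v) refl a (v x)))
    (trans (L-lin M a 0# v v) (solve 2 (λ a v → a :* v :+ :0 :* v := a :* v) refl a (L M v)))

  -- Formally the alternating sum of v x + v (x + 1) telescopes to v 0; the vanishing M-th
  -- difference makes this exact for the truncated functional.
  L-symm : ∀ M v → Deg< M v → L M (λ x → v x + v (suc x)) ≈ (1# + 1#) * v 0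
  L-symm zero    v p = sym (trans (*-congˡ (p 0)) (zeroʳ _))
  L-symm (suc M) v p = begin
    v 0 + v 1 + ½ * L M (∇ λ x → v x + v (suc x))
      ≈⟨ +-congˡ (*-congˡ (L-cong M λ x →
           solve 3 (λ a b c → (a :+ b) :- (b :+ c) := (a :- b) :+ (b :- c)) refl (v x) (v (1 ℕ.+ x)) (v (2 ℕ.+ x)))) ⟩
    v 0 + v 1 + ½ * L M (λ x → ∇ v x + ∇ v (suc x))
      ≈⟨ +-congˡ (*-congˡ (L-symm M (∇ v) p)) ⟩
    v 0 + v 1 + ½ * ((1# + 1#) * (v 0 - v 1))
      ≈⟨ +-congˡ (trans (solve 2 (λ h x → h :* (:2 :* x) := h :* x :+ h :* x) refl ½ (v 0 - v 1)) (½+½ _)) ⟩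
    v 0 + v 1 + (v 0 - v 1)
      ≈⟨ solve 2 (λ a b → a :+ b :+ (a :- b) := :2 :* a) refl (v 0) (v 1) ⟩
    (1# + 1#) * v 0 ∎

  Deg<-mono : ∀ {d M v} → d ℕ.≤ M → Deg< d v → Deg< M v
  Deg<-mono {M = zero}          ℕ.z≤n     p = p
  Deg<-mono {M = suc M} {v}     ℕ.z≤n     p = Deg<-suc M {v} (Deg<-mono {M = M} {v} ℕ.z≤n p)
  Deg<-mono {suc d} {suc M} {v} (ℕ.s≤s l) p = Deg<-mono {d} {M} {∇ v} l p

  -- The Delannoy numbers, with generating function ∑ₙ D j n zⁿ = (1 + z)ʲ / (1 - z)ʲ⁺¹.
  D : ℕ → ℕ → Carrier
  D zero    n       = 1#
  D (suc j) zero    = 1#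
  D (suc j) (suc n) = D (suc j) n + D j (suc n) + D j n

  D-0 : ∀ j → D j 0 ≈ 1#
  D-0 zero    = refl
  D-0 (suc j) = refl

  Deg<-D : ∀ j → Deg< (suc j) (D j)
  Deg<-D zero    n = -‿inverseʳ 1#
  Deg<-D (suc j) = Deg<-cong (suc j)
    (λ n → solve 3 (λ a b c → :- :1 :* b :+ :- :1 :* c := a :- (a :+ b :+ c)) refl (D (suc j) n) (D j (suc n)) (D j n))
    (Deg<-lin (suc j) (- 1#) (- 1#) (Deg<-shift (suc j) {D j} (Deg<-D j)) (Deg<-D j))

  -- Symmetrised so that `L-symm` evaluates `L` on it. The natural variable becomes 2 x + 2,
  -- matching 4 (x² + 2 x) = (2 x + 2)² - 4.
  K : ℕ → ℕ → Carrier
  K j x = D j x + D j (suc x)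

  L-K : ∀ {M j} → j ℕ.< M → L M (K j) ≈ 1# + 1#
  L-K {M} {j} j<M = trans (L-symm M (D j) (Deg<-mono {suc j} {M} {D j} j<M (Deg<-D j)))
    (trans (*-congˡ (D-0 j)) (*-identityʳ _))

  L-D-zero : ∀ {M} → 0 ℕ.< M → L M (D 0) ≈ 1#
  L-D-zero {M} 0<M = *-cancelˡ-≈ 0<2 (trans (sym (L-* M (1# + 1#) (D 0)))
    (trans (L-cong M (λ x → *-identityʳ _)) (trans (L-K {M} {0} 0<M) (sym (*-identityʳ _)))))

  -- 2 D (j + 1) = K (j + 1) - K j, and `L M` takes the value 2 on both.
  L-D-suc : ∀ {M j} → suc j ℕ.< M → L M (D (suc j)) ≈ 0#
  L-D-suc {M} {j} j<M = *-cancelˡ-≈ 0<2 (begin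
    (1# + 1#) * L M (D (suc j))
      ≈⟨ solve 1 (λ l → :2 :* l := :2 :* l :+ :2 :- :2) refl (L M (D (suc j))) ⟩
    (1# + 1#) * L M (D (suc j)) + (1# + 1#) - (1# + 1#)
      ≈⟨ +-congʳ (+-cong (sym (L-* M (1# + 1#) (D (suc j)))) (sym (L-K {M} {j} (ℕ.<-trans (ℕ.n<1+n j) j<M)))) ⟩
    L M (λ x → (1# + 1#) * D (suc j) x) + L M (K j) - (1# + 1#)
      ≈⟨ +-congʳ (L-+ M _ (K j)) ⟨
    L M (λ x → (1# + 1#) * D (suc j) x + K j x) - (1# + 1#)
      ≈⟨ +-congʳ (L-cong M (λ x → solve 3 (λ a b c → :2 :* a :+ (b :+ c) := a :+ (a :+ c :+ b)) refl
           (D (suc j) x) (D j x) (D j (suc x)))) ⟩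
    L M (K (suc j)) - (1# + 1#)
      ≈⟨ +-congʳ (L-K {M} {suc j} j<M) ⟩
    (1# + 1#) - (1# + 1#)
      ≈⟨ solve 0 (:2 :- :2 := :2 :* :0) refl ⟩
    (1# + 1#) * 0# ∎)

  -- Defect of the three-term recurrence in j. At j = 0 `ℕ.pred` puts D 0 in the place of index - 1,
  -- where the coefficient `ι j` is 0.
  D-defect : ℕ → ℕ → Carrier
  D-defect j n = ι (suc j) * D (suc j) n - ι j * D (ℕ.pred j) n - (1# + (1# + 1#) * ι n) * D j n

  -- The defect inherits the Delannoy rule in (j, n), so it vanishes by induction from the edges.
  D-defect≈0 : ∀ j n → D-defect j n ≈ 0#
  D-defect≈0 j zero = trans (+-cong (+-congˡ (-‿cong (*-congˡ (D-0 (ℕ.pred j))))) (-‿cong (*-congˡ (D-0 j))))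
    (solve 1 (λ j → (:1 :+ j) :* :1 :- j :* :1 :- (:1 :+ :2 :* :0) :* :1 := :0) refl (ι j))
  D-defect≈0 zero (suc n) = trans
    (solve 2 (λ n d → (:1 :+ :0) :* (d :+ :1 :+ :1) :- :0 :* :1 :- (:1 :+ :2 :* (:1 :+ n)) :* :1
                := (:1 :+ :0) :* d :- :0 :* :1 :- (:1 :+ :2 :* n) :* :1) refl (ι n) (D 1 n))
    (D-defect≈0 0 n)
  D-defect≈0 (suc j) (suc n) = trans (pascal j) (trans
    (+-cong (+-cong (D-defect≈0 (suc j) n) (D-defect≈0 j (suc n))) (D-defect≈0 j n))
    (solve 0 (:0 :+ :0 :+ :0 := :0) refl))
    where
    pascal : ∀ j → D-defect (suc j) (suc n) ≈ D-defect (suc j) n + D-defect j (suc n) + D-defect j n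
    pascal zero = solve 3 (λ n d₁ d₂ →
        let d₀ = :1
            d₁′ = d₁ :+ :1 :+ :1
            d₂′ = d₂ :+ d₁′ :+ d₁ in
        (:1 :+ (:1 :+ :0)) :* d₂′ :- (:1 :+ :0) :* d₀ :- (:1 :+ :2 :* (:1 :+ n)) :* d₁′
          := ((:1 :+ (:1 :+ :0)) :* d₂ :- (:1 :+ :0) :* d₀ :- (:1 :+ :2 :* n) :* d₁)
             :+ ((:1 :+ :0) :* d₁′ :- :0 :* d₀ :- (:1 :+ :2 :* (:1 :+ n)) :* d₀)
             :+ ((:1 :+ :0) :* d₁ :- :0 :* d₀ :- (:1 :+ :2 :* n) :* d₀))
      refl (ι n) (D 1 n) (D 2 n)
    pascal (suc j) = solve 7 (λ j n d₀ d₀′ d₁ d₂ d₃ →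
        let d₁′ = d₁ :+ d₀′ :+ d₀
            d₂′ = d₂ :+ d₁′ :+ d₁
            d₃′ = d₃ :+ d₂′ :+ d₂ in
        (:1 :+ (:1 :+ (:1 :+ j))) :* d₃′ :- (:1 :+ (:1 :+ j)) :* d₁′ :- (:1 :+ :2 :* (:1 :+ n)) :* d₂′
          := ((:1 :+ (:1 :+ (:1 :+ j))) :* d₃ :- (:1 :+ (:1 :+ j)) :* d₁ :- (:1 :+ :2 :* n) :* d₂)
             :+ ((:1 :+ (:1 :+ j)) :* d₂′ :- (:1 :+ j) :* d₀′ :- (:1 :+ :2 :* (:1 :+ n)) :* d₁′)
             :+ ((:1 :+ (:1 :+ j)) :* d₂ :- (:1 :+ j) :* d₀ :- (:1 :+ :2 :* n) :* d₁))
      refl (ι j) (ι n) (D j n) (D j (suc n)) (D (1 ℕ.+ j) n) (D (2 ℕ.+ j) n) (D (3 ℕ.+ j) n)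

  D-rec : ∀ j n → (1# + (1# + 1#) * ι n) * D j n ≈ ι (suc j) * D (suc j) n - ι j * D (ℕ.pred j) n
  D-rec j n = begin
    (1# + (1# + 1#) * ι n) * D j n
      ≈⟨ solve 3 (λ a b c → c := a :- b :- (a :- b :- c)) refl
           (ι (suc j) * D (suc j) n) (ι j * D (ℕ.pred j) n) ((1# + (1# + 1#) * ι n) * D j n) ⟩
    ι (suc j) * D (suc j) n - ι j * D (ℕ.pred j) n - D-defect j n
      ≈⟨ trans (+-congˡ (-‿cong (D-defect≈0 j n))) (x-0≈x _) ⟩
    ι (suc j) * D (suc j) n - ι j * D (ℕ.pred j) n ∎

  ι-dbl : ∀ k → ι (dbl k) ≈ (1# + 1#) * ι k
  ι-dbl zero    = sym (zeroʳ _)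
  ι-dbl (suc k) = trans (+-congˡ (+-congˡ (ι-dbl k)))
    (solve 1 (λ k → :1 :+ (:1 :+ :2 :* k) := :2 :* (:1 :+ k)) refl (ι k))

  odd : ℕ → Carrier
  odd n = 1# + (1# + 1#) * ι n

  ι-1+dbl : ∀ k → ι (suc (dbl k)) ≈ odd k
  ι-1+dbl k = +-congˡ (ι-dbl k)

  D-rec-odd : ∀ k x → odd x * D (suc (dbl k)) x ≈ (1# + odd k) * D (dbl (suc k)) x - odd k * D (dbl k) x
  D-rec-odd k x = trans (D-rec (suc (dbl k)) x)
    (+-cong (*-congʳ (+-congˡ (ι-1+dbl k))) (-‿cong (*-congʳ (ι-1+dbl k))))

  D-rec-even : ∀ k x →
    odd x * D (dbl (suc k)) x ≈ odd (suc k) * D (suc (dbl (suc k))) x - (1# + odd k) * D (suc (dbl k)) x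
  D-rec-even k x = trans (D-rec (dbl (suc k)) x)
    (+-cong (*-congʳ (ι-1+dbl (suc k))) (-‿cong (*-congʳ (+-congˡ (ι-1+dbl k)))))

  -- A three-term recurrence applied twice: multiplication by y² leads from even indices back to
  -- even indices.
  twice : ∀ {y d d₁ d₀ a b p r} → y * d ≈ a * d₁ - b * d₀ → y * d₁ ≈ p → y * d₀ ≈ r →
    y * (y * d) ≈ a * p - b * r
  twice {y} {d} {d₁} {d₀} {a} {b} h h₁ h₀ = trans (*-congˡ h) (trans
    (solve 5 (λ y a d₁ b d₀ → y :* (a :* d₁ :- b :* d₀) := a :* (y :* d₁) :- b :* (y :* d₀)) refl y a d₁ b d₀)
    (+-cong (*-congˡ h₁) (-‿cong (*-congˡ h₀))))

  -2e : ℕ → ℕ → Carrier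
  -2e b x = - ((1# + 1#) * ι (e b x))

  α β ρ : ℕ → Carrier
  α k = odd k * (1# + ι k)
  β k = odd k + (1# + 1#) * ι k * ((1# + 1#) * ι k)
  ρ k = odd k * ι k

  Γ : ℕ → ℕ → Carrier
  Γ k x = (- 1#) ^ k * D (dbl k) x

  -- The lower neighbour together with its coefficient, which at index k + 1 is `α k`, the same as
  -- for the upward step from k.
  Γ⁻ : ℕ → ℕ → Carrier
  Γ⁻ zero    x = 0#
  Γ⁻ (suc k) x = α k * Γ k x

  -- Twice the multiplier is 1 - (2 x + 1)², and `twice` expands the square. The sign (-1)ᵏ makes
  -- the coefficients of both neighbours positive; the middle one already is.
  -2e-Γ : ∀ k x → -2e 1 x * Γ k x ≈ α k * Γ (suc k) x + 1# * (β k * Γ k x + 1# * Γ⁻ k x)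
  -2e-Γ k x = *-cancelˡ-≈ 0<2 (begin
    (1# + 1#) * (-2e 1 x * Γ k x)
      ≈⟨ *-congˡ (*-congʳ (-‿cong (*-congˡ (ι-e 1 0 x)))) ⟩
    (1# + 1#) * (- ((1# + 1#) * (0# + (ι x * ι x + (1# + 0#) * ι x))) * Γ k x)
      ≈⟨ solve 3 (λ x s d →
           let y = :1 :+ :2 :* x in
           :2 :* (:- (:2 :* (:0 :+ (x :* x :+ (:1 :+ :0) :* x))) :* (s :* d)) := s :* (d :- y :* (y :* d)))
           refl (ι x) ((- 1#) ^ k) (D (dbl k) x) ⟩
    (- 1#) ^ k * (D (dbl k) x - odd x * (odd x * D (dbl k) x))
      ≈⟨ step k ⟩
    (1# + 1#) * (α k * Γ (suc k) x + 1# * (β k * Γ k x + 1# * Γ⁻ k x)) ∎)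
    where
    step : ∀ k → (- 1#) ^ k * (D (dbl k) x - odd x * (odd x * D (dbl k) x))
      ≈ (1# + 1#) * (α k * Γ (suc k) x + 1# * (β k * Γ k x + 1# * Γ⁻ k x))
    step zero = trans (*-congˡ (+-congˡ (-‿cong (twice (D-rec 0 x) (D-rec-odd 0 x) refl))))
      (solve 2 (λ d₂ z →
          let o = :1 :+ :2 :* :0 in
          :1 :* (:1 :- ((:1 :+ :0) :* ((:1 :+ o) :* d₂ :- o :* :1) :- :0 :* z))
            := :2 :* (o :* (:1 :+ :0) :* (:- :1 :* :1 :* d₂)
                 :+ :1 :* ((o :+ :2 :* :0 :* (:2 :* :0)) :* (:1 :* :1) :+ :1 :* :0)))
        refl (D 2 x) (odd x * D 0 x))
    step (suc k) = trans
      (*-congˡ (+-congˡ (-‿cong (twice (D-rec-even k x) (D-rec-odd (suc k) x) (D-rec-odd k x)))))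
      (solve 5 (λ k s d₀ d₂ d₄ →
          let o = :1 :+ :2 :* k
              k′ = :1 :+ k
              o′ = :1 :+ :2 :* k′
              s′ = :- :1 :* s in
          s′ :* (d₂ :- (o′ :* ((:1 :+ o′) :* d₄ :- o′ :* d₂) :- (:1 :+ o) :* ((:1 :+ o) :* d₂ :- o :* d₀)))
            := :2 :* (o′ :* (:1 :+ k′) :* (:- :1 :* s′ :* d₄)
                 :+ :1 :* ((o′ :+ :2 :* k′ :* (:2 :* k′)) :* (s′ :* d₂) :+ :1 :* (o :* (:1 :+ k) :* (s :* d₀)))))
        refl (ι k) ((- 1#) ^ k) (D (dbl k) x) (D (dbl (1 ℕ.+ k)) x) (D (dbl (2 ℕ.+ k)) x))

  -- Writing 2 x + 2 as (2 x + 1) + 1 at x and as (2 x + 3) - 1 at x + 1 reduces the claim to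
  -- `D-rec`, with correction - K j.
  K-rec : ∀ j x → (1# + odd x) * K (suc j) x ≈ ι (2 ℕ.+ j) * K (2 ℕ.+ j) x - ι (2 ℕ.+ j) * K j x
  K-rec j x = begin
    (1# + odd x) * (d₁ + d₁′)
      ≈⟨ solve 4 (λ x a b c → let d₁ = a in
           (:1 :+ (:1 :+ :2 :* x)) :* (d₁ :+ (d₁ :+ b :+ c))
             := (:1 :+ :2 :* x) :* d₁ :+ (:1 :+ :2 :* (:1 :+ x)) :* (d₁ :+ b :+ c) :- (c :+ b))
           refl (ι x) d₁ (D j (suc x)) (D j x) ⟩
    odd x * d₁ + odd (suc x) * d₁′ - K j x
      ≈⟨ +-congʳ (+-cong (D-rec (suc j) x) (D-rec (suc j) (suc x))) ⟩
    (J * D (2 ℕ.+ j) x - ι (suc j) * D j x) + (J * D (2 ℕ.+ j) (suc x) - ι (suc j) * D j (suc x)) - K j x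
      ≈⟨ solve 5 (λ j a b c d →
           ((:1 :+ j) :* a :- j :* c) :+ ((:1 :+ j) :* b :- j :* d) :- (c :+ d)
             := (:1 :+ j) :* (a :+ b) :- (:1 :+ j) :* (c :+ d))
           refl (ι (suc j)) (D (2 ℕ.+ j) x) (D (2 ℕ.+ j) (suc x)) (D j x) (D j (suc x)) ⟩
    J * K (2 ℕ.+ j) x - J * K j x ∎
    where
    J   = ι (2 ℕ.+ j)
    d₁  = D (suc j) x
    d₁′ = D (suc j) (suc x)

  -- The zero multiple of `K 0` stands in for index - 1, giving the shape that `twice` expects.
  K-rec-zero : ∀ x → (1# + odd x) * K 0 x ≈ 1# * K 1 x - 0# * K 0 x
  K-rec-zero x = trans
    (solve 1 (λ x → (:1 :+ (:1 :+ :2 :* x)) :* (:1 :+ :1)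
        := (:1 :+ :2 :* x) :* :1 :+ (:1 :+ :2 :* (:1 :+ x)) :* :1) refl (ι x))
    (trans (+-cong (D-rec 0 x) (D-rec 0 (suc x)))
      (solve 2 (λ a b → ((:1 :+ :0) :* a :- :0 :* :1) :+ ((:1 :+ :0) :* b :- :0 :* :1)
          := :1 :* (a :+ b) :- :0 :* (:1 :+ :1)) refl (D 1 x) (D 1 (suc x))))

  K-rec-odd : ∀ k x →
    (1# + odd x) * K (suc (dbl k)) x ≈ (1# + odd k) * K (dbl (suc k)) x - (1# + odd k) * K (dbl k) x
  K-rec-odd k x = trans (K-rec (dbl k) x)
    (+-cong (*-congʳ (+-congˡ (ι-1+dbl k))) (-‿cong (*-congʳ (+-congˡ (ι-1+dbl k)))))

  K-rec-even : ∀ k x → (1# + odd x) * K (dbl (suc k)) x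
    ≈ odd (suc k) * K (suc (dbl (suc k))) x - odd (suc k) * K (suc (dbl k)) x
  K-rec-even k x = trans (K-rec (suc (dbl k)) x)
    (+-cong (*-congʳ (ι-1+dbl (suc k))) (-‿cong (*-congʳ (ι-1+dbl (suc k)))))

  -- The value `K 0` at index 0, where the coefficient `ρ 0` is 0, lets `κ⁻` treat all indices
  -- alike.
  K⁻ : ℕ → ℕ → Carrier
  K⁻ zero    = K 0
  K⁻ (suc k) = K (dbl k)

  -- The coefficients on the right add up to 2, so the pairings below do not depend on k.
  -2e-K : ∀ k x → -2e 2 x * K (dbl k) x
    ≈ - α k * K (dbl (suc k)) x + 1# * ((1# + 1# + α k + ρ k) * K (dbl k) x + - ρ k * K⁻ k x)
  -2e-K k x = *-cancelˡ-≈ 0<2 (begin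
    (1# + 1#) * (-2e 2 x * K (dbl k) x)
      ≈⟨ *-congˡ (*-congʳ (-‿cong (*-congˡ (ι-e 2 0 x)))) ⟩
    (1# + 1#) * (- ((1# + 1#) * (0# + (ι x * ι x + (1# + (1# + 0#)) * ι x))) * K (dbl k) x)
      ≈⟨ solve 2 (λ x d →
           let y = :1 :+ (:1 :+ :2 :* x) in
           :2 :* (:- (:2 :* (:0 :+ (x :* x :+ (:1 :+ (:1 :+ :0)) :* x))) :* d) := :2 :* (:2 :* d) :- y :* (y :* d))
           refl (ι x) (K (dbl k) x) ⟩
    (1# + 1#) * ((1# + 1#) * K (dbl k) x) - (1# + odd x) * ((1# + odd x) * K (dbl k) x)
      ≈⟨ step k ⟩
    (1# + 1#) * (- α k * K (dbl (suc k)) x + 1# * ((1# + 1# + α k + ρ k) * K (dbl k) x + - ρ k * K⁻ k x)) ∎)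
    where
    step : ∀ k → (1# + 1#) * ((1# + 1#) * K (dbl k) x) - (1# + odd x) * ((1# + odd x) * K (dbl k) x)
      ≈ (1# + 1#) * (- α k * K (dbl (suc k)) x + 1# * ((1# + 1# + α k + ρ k) * K (dbl k) x + - ρ k * K⁻ k x))
    step zero = trans (+-congˡ (-‿cong (twice (K-rec-zero x) (K-rec-odd 0 x) refl)))
      (solve 3 (λ d₀ d₂ z →
          let o = :1 :+ :2 :* :0 in
          :2 :* (:2 :* d₀) :- (:1 :* ((:1 :+ o) :* d₂ :- (:1 :+ o) :* d₀) :- :0 :* z)
            := :2 :* (:- (o :* (:1 :+ :0)) :* d₂
                 :+ :1 :* ((:1 :+ :1 :+ o :* (:1 :+ :0) :+ o :* :0) :* d₀ :+ :- (o :* :0) :* d₀)))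
        refl (K 0 x) (K 2 x) ((1# + odd x) * K 0 x))
    step (suc k) = trans
      (+-congˡ (-‿cong (twice (K-rec-even k x) (K-rec-odd (suc k) x) (K-rec-odd k x))))
      (solve 4 (λ k d₀ d₂ d₄ →
          let o = :1 :+ :2 :* k
              k′ = :1 :+ k
              o′ = :1 :+ :2 :* k′ in
          :2 :* (:2 :* d₂) :- (o′ :* ((:1 :+ o′) :* d₄ :- (:1 :+ o′) :* d₂) :- o′ :* ((:1 :+ o) :* d₂ :- (:1 :+ o) :* d₀))
            := :2 :* (:- (o′ :* (:1 :+ k′)) :* d₄
                 :+ :1 :* ((:1 :+ :1 :+ o′ :* (:1 :+ k′) :+ o′ :* k′) :* d₂ :+ :- (o′ :* k′) :* d₀)))
        refl (ι k) (K (dbl k) x) (K (dbl (1 ℕ.+ k)) x) (K (dbl (2 ℕ.+ k)) x))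

-- Signs of the coefficients.

module Signs {c ℓ₁ ℓ₂} (ℝ : RealField c ℓ₁ ℓ₂) where
  open Ordered ℝ
  open Analysis ℝ
  open Taylor ℝ
  open Delannoy ℝ
  open import Relation.Binary.Reasoning.Setoid setoid

  module _ (M b : ℕ) where

    ⟨_∣_⟩ : (ℕ → Carrier) → ℕ → Carrier
    ⟨ v ∣ n ⟩ = L M (λ x → v x * w n (e b x))

    ⟨⟩-cong : ∀ {v v′} n → (∀ x → v x ≈ v′ x) → ⟨ v ∣ n ⟩ ≈ ⟨ v′ ∣ n ⟩
    ⟨⟩-cong n p = L-cong M (λ x → *-congʳ (p x))

    ⟨⟩-lin : ∀ n a a′ v v′ → ⟨ (λ x → a * v x + a′ * v′ x) ∣ n ⟩ ≈ a * ⟨ v ∣ n ⟩ + a′ * ⟨ v′ ∣ n ⟩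
    ⟨⟩-lin n a a′ v v′ = trans
      (L-cong M (λ x → solve 5 (λ a v a′ v′ w → (a :* v :+ a′ :* v′) :* w := a :* (v :* w) :+ a′ :* (v′ :* w))
        refl a (v x) a′ (v′ x) (w n (e b x))))
      (L-lin M a a′ _ _)

    ⟨⟩-0 : ∀ v → ⟨ v ∣ 0 ⟩ ≈ L M v
    ⟨⟩-0 v = L-cong M (λ x → *-identityʳ (v x))

    ⟨⟩-1 : ∀ v → ⟨ v ∣ 1 ⟩ ≈ ⟨ (λ x → -2e b x * v x) ∣ 0 ⟩
    ⟨⟩-1 v = L-cong M (λ x → trans (*-congˡ (w-1 (e b x)))
      (solve 2 (λ v m → v :* m := m :* v :* :1) refl (v x) (-2e b x)))

    -- The differential equation `w-rec` applied under `L`, with the factor - 2 e moved onto v.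
    ⟨⟩-rec : ∀ v n → ι (2 ℕ.+ n) * ⟨ v ∣ 2 ℕ.+ n ⟩ ≈ ι n * ⟨ v ∣ n ⟩ + ⟨ (λ x → -2e b x * v x) ∣ 1 ℕ.+ n ⟩
    ⟨⟩-rec v n = begin
      ι (2 ℕ.+ n) * ⟨ v ∣ 2 ℕ.+ n ⟩
        ≈⟨ L-* M (ι (2 ℕ.+ n)) _ ⟨
      L M (λ x → ι (2 ℕ.+ n) * (v x * w (2 ℕ.+ n) (e b x)))
        ≈⟨ L-cong M (λ x → trans
             (solve 3 (λ n v w → n :* (v :* w) := v :* (n :* w)) refl (ι (2 ℕ.+ n)) (v x) (w (2 ℕ.+ n) (e b x)))
             (trans (*-congˡ (w-rec n (e b x)))
             (solve 5 (λ v n w E w₁ → v :* (n :* w :- :2 :* E :* w₁) := n :* (v :* w) :+ :1 :* (:- (:2 :* E) :* v :* w₁))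
               refl (v x) (ι n) (w n (e b x)) (ι (e b x)) (w (1 ℕ.+ n) (e b x))))) ⟩
      L M (λ x → ι n * (v x * w n (e b x)) + 1# * (-2e b x * v x * w (1 ℕ.+ n) (e b x)))
        ≈⟨ L-lin M (ι n) 1# _ _ ⟩
      ι n * ⟨ v ∣ n ⟩ + 1# * ⟨ (λ x → -2e b x * v x) ∣ 1 ℕ.+ n ⟩
        ≈⟨ +-congˡ (*-identityˡ _) ⟩
      ι n * ⟨ v ∣ n ⟩ + ⟨ (λ x → -2e b x * v x) ∣ 1 ℕ.+ n ⟩ ∎

    ⟨⟩-lin₃ : ∀ n a₁ a₂ a₃ (v v₁ v₂ v₃ : ℕ → Carrier) →
      (∀ x → -2e b x * v x ≈ a₁ * v₁ x + 1# * (a₂ * v₂ x + a₃ * v₃ x)) →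
      ⟨ (λ x → -2e b x * v x) ∣ n ⟩ ≈ a₁ * ⟨ v₁ ∣ n ⟩ + (a₂ * ⟨ v₂ ∣ n ⟩ + a₃ * ⟨ v₃ ∣ n ⟩)
    ⟨⟩-lin₃ n a₁ a₂ a₃ v v₁ v₂ v₃ p = trans (⟨⟩-cong n p)
      (trans (⟨⟩-lin n a₁ 1# v₁ _) (+-congˡ (trans (*-identityˡ _) (⟨⟩-lin n a₂ a₃ v₂ v₃))))

  1≤odd : ∀ k → 1# ≤ odd k
  1≤odd k = ≤-resp (+-identityʳ 1#) refl (+-monoʳ-≤ 1# (*-nonneg (<⇒≤ 0<2) (0≤n·1 k)))

  1≤α : ∀ k → 1# ≤ α k
  1≤α k = ≤-resp (*-identityʳ 1#) refl (*-mono-≤ 0≤1 0≤1 (1≤odd k)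
    (≤-resp (+-identityʳ 1#) refl (+-monoʳ-≤ 1# (0≤n·1 k))))

  1≤β : ∀ k → 1# ≤ β k
  1≤β k = ≤-resp (+-identityʳ 1#) refl (+-mono-≤ (1≤odd k) (*-nonneg 0≤2k 0≤2k))
    where
    0≤2k = *-nonneg (<⇒≤ 0<2) (0≤n·1 k)

  -- The base cases b = 1 and b = 2, at a fixed index N.

  module _ (N : ℕ) where

    private
      -- One truncation serves the whole recursion: lowering n by 1 raises k by at most 1, so only
      -- pairs with k + n ≤ N occur, and at n = 0 the degree 2 k is below M.
      M = suc (dbl N)

      γ : ℕ → ℕ → Carrier
      γ k n = ⟨_∣_⟩ M 1 (Γ k) n

      γ⁻ : ℕ → ℕ → Carrier
      γ⁻ k n = ⟨_∣_⟩ M 1 (Γ⁻ k) n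

      R : ℕ → ℕ → Carrier
      R k n = α k * γ (suc k) n + (β k * γ k n + 1# * γ⁻ k n)

      γ-1 : ∀ k → γ k 1 ≈ R k 0
      γ-1 k = trans (⟨⟩-1 M 1 (Γ k)) (⟨⟩-lin₃ M 1 0 (α k) (β k) 1# (Γ k) (Γ (suc k)) (Γ k) (Γ⁻ k) (-2e-Γ k))

      γ-rec : ∀ k n → ι (2 ℕ.+ n) * γ k (2 ℕ.+ n) ≈ ι n * γ k n + R k (1 ℕ.+ n)
      γ-rec k n = trans (⟨⟩-rec M 1 (Γ k) n)
        (+-congˡ (⟨⟩-lin₃ M 1 (1 ℕ.+ n) (α k) (β k) 1# (Γ k) (Γ (suc k)) (Γ k) (Γ⁻ k) (-2e-Γ k)))

      γ⁻-zero : ∀ n → γ⁻ 0 n ≈ 0#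
      γ⁻-zero n = trans (L-cong M (λ x → solve 1 (λ w → :0 :* w := :0 :* (:0 :* w)) refl (w n (e 1 x))))
        (trans (L-* M 0# _) (zeroˡ _))

      γ⁻-suc : ∀ k n → γ⁻ (suc k) n ≈ α k * γ k n
      γ⁻-suc k n = trans (L-cong M (λ x → *-assoc _ _ _)) (L-* M (α k) _)

      γ-zero : γ 0 0 ≈ 1#
      γ-zero = trans (⟨⟩-0 M 1 (Γ 0)) (trans (L-cong M (λ x → *-identityˡ 1#)) (L-D-zero {M} (ℕ.s≤s ℕ.z≤n)))

      γ-suc : ∀ k → suc k ℕ.≤ N → γ (suc k) 0 ≈ 0#
      γ-suc k k<N = trans (⟨⟩-0 M 1 (Γ (suc k))) (trans (L-* M ((- 1#) ^ suc k) (D (dbl (suc k))))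
        (trans (*-congˡ (L-D-suc {M} {suc (dbl k)} (ℕ.s≤s (dbl-mono k<N)))) (zeroʳ _)))

      1≤⇒0≤ : ∀ {x} → 1# ≤ x → 0# ≤ x
      1≤⇒0≤ = ≤-trans 0≤1

      lower : ∀ {k n} → suc k ℕ.+ n ℕ.≤ N → k ℕ.+ n ℕ.≤ N
      lower = ℕ.≤-trans (ℕ.n≤1+n _)

      R-nonneg : ∀ n → (∀ k → k ℕ.+ n ℕ.≤ N → 0# ≤ γ k n) → ∀ k → suc k ℕ.+ n ℕ.≤ N → 0# ≤ R k n
      R-nonneg n IH k l = +-nonneg (*-nonneg (1≤⇒0≤ (1≤α k)) (IH (suc k) l))
        (+-nonneg (*-nonneg (1≤⇒0≤ (1≤β k)) (IH k (lower {k} l))) (*-nonneg 0≤1 (0≤γ⁻ k l)))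
        where
        0≤γ⁻ : ∀ k → suc k ℕ.+ n ℕ.≤ N → 0# ≤ γ⁻ k n
        0≤γ⁻ zero    l = ≤-reflexive (sym (γ⁻-zero n))
        0≤γ⁻ (suc k) l = ≤-resp refl (sym (γ⁻-suc k n))
          (*-nonneg (1≤⇒0≤ (1≤α k)) (IH k (lower {k} (lower {suc k} l))))

      shift : ∀ k n → k ℕ.+ suc n ℕ.≤ N → suc k ℕ.+ n ℕ.≤ N
      shift k n = ≡.subst (ℕ._≤ N) (ℕ.+-suc k n)

      -- The values at n = 0 are 1, 0, 0, ..., and all coefficients of the recurrence are
      -- non-negative.
      γ-nonneg : ∀ n k → k ℕ.+ n ℕ.≤ N → 0# ≤ γ k n
      γ-nonneg zero          zero    l = ≤-resp refl (sym γ-zero) 0≤1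
      γ-nonneg zero          (suc k) l =
        ≤-reflexive (sym (γ-suc k (≡.subst (ℕ._≤ N) (ℕ.+-identityʳ (suc k)) l)))
      γ-nonneg (suc zero)    k       l =
        ≤-resp refl (sym (γ-1 k)) (R-nonneg 0 (γ-nonneg 0) k (shift k 0 l))
      γ-nonneg (suc (suc n)) k       l = *-cancelˡ-≤ (0<ι-suc (suc n))
        (≤-resp (sym (zeroʳ _)) (sym (γ-rec k n))
          (+-nonneg (*-nonneg (0≤n·1 n) (γ-nonneg n k (lower {k} (shift k n (lower {k} (shift k (suc n) l))))))
            (R-nonneg (suc n) (γ-nonneg (suc n)) k (shift k (suc n) l))))

      ι-*-mono : ∀ n {x} → 1# ≤ x → ι n ≤ ι n * x
      ι-*-mono n p = ≤-resp (*-identityʳ _) refl (*-monoʳ-≤ (0≤n·1 n) p)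

      1≤* : ∀ {x y} → 1# ≤ x → 1# ≤ y → 1# ≤ x * y
      1≤* p p′ = ≤-resp (*-identityʳ 1#) refl (*-mono-≤ 0≤1 0≤1 p p′)

      -- Joint induction with `γ₁-≥1`: in each recurrence for (n + 2) γ (n + 2) the term at n
      -- contributes at least n, and the terms with `γ 0` and `γ 1` at n + 1 contribute at least 1
      -- each.
      γ₀-≥1 : ∀ n → n ℕ.≤ N → 1# ≤ γ 0 n
      γ₁-≥1 : ∀ n → 2 ℕ.+ n ℕ.≤ N → 1# ≤ γ 1 (suc n)

      γ₀-≥1 zero          l = ≤-reflexive (sym γ-zero)
      γ₀-≥1 (suc zero)    l = ≤-resp (solve 0 (:0 :+ (:1 :+ :0) := :1) refl) (sym (γ-1 0))
        (+-mono-≤ (*-nonneg (1≤⇒0≤ (1≤α 0)) (γ-nonneg 0 1 l))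
          (+-mono-≤ (1≤* (1≤β 0) (γ₀-≥1 0 ℕ.z≤n)) (≤-reflexive (sym (trans (*-identityˡ _) (γ⁻-zero 0))))))
      γ₀-≥1 (suc (suc n)) l = *-cancelˡ-≤ (0<ι-suc (suc n))
        (≤-resp (solve 1 (λ n → n :+ (:1 :+ (:1 :+ :0)) := (:1 :+ (:1 :+ n)) :* :1) refl (ι n)) (sym (γ-rec 0 n))
          (+-mono-≤ (ι-*-mono n (γ₀-≥1 n (ℕ.≤-trans (ℕ.m≤n+m n 2) l)))
            (+-mono-≤ (1≤* (1≤α 0) (γ₁-≥1 n l))
              (+-mono-≤ (1≤* (1≤β 0) (γ₀-≥1 (suc n) (ℕ.≤-trans (ℕ.n≤1+n _) l)))
                (≤-reflexive (sym (trans (*-identityˡ _) (γ⁻-zero (suc n)))))))))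

      1≤γ⁻ : ∀ n → n ℕ.≤ N → 1# ≤ 1# * γ⁻ 1 n
      1≤γ⁻ n l = 1≤* ≤-refl (≤-resp refl (sym (γ⁻-suc 0 n)) (1≤* (1≤α 0) (γ₀-≥1 n l)))

      γ₁-≥1 zero    l = ≤-resp (solve 0 (:0 :+ (:0 :+ :1) := :1) refl) (sym (γ-1 1))
        (+-mono-≤ (*-nonneg (1≤⇒0≤ (1≤α 1)) (γ-nonneg 0 2 l))
          (+-mono-≤ (*-nonneg (1≤⇒0≤ (1≤β 1)) (γ-nonneg 0 1 (ℕ.≤-trans (ℕ.n≤1+n 1) l))) (1≤γ⁻ 0 ℕ.z≤n)))
      γ₁-≥1 (suc n) l = *-cancelˡ-≤ (0<ι-suc (suc n))
        (≤-resp (solve 1 (λ n → n :+ (:0 :+ (:1 :+ :1)) := (:1 :+ (:1 :+ n)) :* :1) refl (ι n)) (sym (γ-rec 1 n))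
          (+-mono-≤ (below-n n l)
            (+-mono-≤ (*-nonneg (1≤⇒0≤ (1≤α 1)) (γ-nonneg (suc n) 2 l))
              (+-mono-≤ (1≤* (1≤β 1) (γ₁-≥1 n (ℕ.≤-trans (ℕ.n≤1+n _) l)))
                (1≤γ⁻ (suc n) (ℕ.≤-trans (ℕ.m≤n+m _ 2) l))))))
        where
        below-n : ∀ n → 3 ℕ.+ n ℕ.≤ N → ι n ≤ ι n * γ 1 n
        -- `γ 1 0` is 0 and not at least 1; the bound holds because of the factor `ι 0`.
        below-n zero    l = ≤-reflexive (sym (zeroˡ _))
        below-n (suc n) l = ι-*-mono (suc n) (γ₁-≥1 n (ℕ.≤-trans (ℕ.m≤n+m _ 2) l))

    coeff₁-≥1 : 1# ≤ coeff 1 0 N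
    coeff₁-≥1 = ≤-resp refl (L-cong M (λ x → solve 1 (λ w → :1 :* :1 :* w := w) refl (w N (e 1 x))))
      (γ₀-≥1 N ℕ.≤-refl)

    private
      κ : ℕ → ℕ → Carrier
      κ k n = ⟨_∣_⟩ M 2 (K (dbl k)) n

      κ⁻ : ∀ k n {C} → (∀ k′ → k′ ℕ.≤ k → κ k′ n ≈ C) → ⟨_∣_⟩ M 2 (K⁻ k) n ≈ C
      κ⁻ zero    n p = p 0 ℕ.≤-refl
      κ⁻ (suc k) n p = p k (ℕ.n≤1+n k)

      -- The three coefficients of `-2e-K` add up to 2, so a value common to all k is doubled.
      -2e-κ : ∀ k n {C} → (∀ k′ → k′ ℕ.≤ suc k → κ k′ n ≈ C) →
        ⟨_∣_⟩ M 2 (λ x → -2e 2 x * K (dbl k) x) n ≈ (1# + 1#) * C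
      -2e-κ k n {C} p = trans
        (⟨⟩-lin₃ M 2 n (- α k) (1# + 1# + α k + ρ k) (- ρ k) (K (dbl k)) (K (dbl (suc k))) (K (dbl k)) (K⁻ k) (-2e-K k))
        (trans (+-cong (*-congˡ (p (suc k) ℕ.≤-refl)) (+-cong (*-congˡ (p k (ℕ.n≤1+n k)))
            (*-congˡ (κ⁻ k n (λ k′ l → p k′ (ℕ.≤-trans l (ℕ.n≤1+n k)))))))
          (solve 3 (λ a r C → :- a :* C :+ ((:1 :+ :1 :+ a :+ r) :* C :+ :- r :* C) := :2 :* C) refl (α k) (ρ k) C))

      4# : Carrier
      4# = (1# + 1#) * (1# + 1#)

      -- Twice the coefficients 1, 2, 2, ... of (1 + t) / (1 - t), since `K 0` is the constant 2.
      κ-value : ℕ → Carrier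
      κ-value zero    = 1# + 1#
      κ-value (suc _) = 4#

      κ≈ : ∀ n k → k ℕ.+ n ℕ.≤ N → κ k n ≈ κ-value n
      κ≈-below : ∀ n k → k ℕ.+ suc n ℕ.≤ N → ∀ k′ → k′ ℕ.≤ suc k → κ k′ n ≈ κ-value n
      κ≈-below n k l k′ k′≤ = κ≈ n k′ (ℕ.≤-trans (ℕ.+-monoˡ-≤ n k′≤) (shift k n l))

      κ≈ zero k l = trans (⟨⟩-0 M 2 (K (dbl k)))
        (L-K {M} {dbl k} (ℕ.s≤s (dbl-mono (≡.subst (ℕ._≤ N) (ℕ.+-identityʳ k) l))))
      κ≈ (suc zero) k l = trans (⟨⟩-1 M 2 (K (dbl k))) (-2e-κ k 0 (κ≈-below 0 k l))
      κ≈ (suc (suc n)) k l = *-cancelˡ-≈ (0<ι-suc (suc n)) (begin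
        ι (2 ℕ.+ n) * κ k (2 ℕ.+ n)
          ≈⟨ ⟨⟩-rec M 2 (K (dbl k)) n ⟩
        ι n * κ k n + ⟨_∣_⟩ M 2 (λ x → -2e 2 x * K (dbl k) x) (suc n)
          ≈⟨ +-cong (first n l) (-2e-κ k (suc n) (κ≈-below (suc n) k l)) ⟩
        ι n * 4# + (1# + 1#) * 4#
          ≈⟨ solve 2 (λ n c → n :* c :+ :2 :* c := (:1 :+ (:1 :+ n)) :* c) refl (ι n) 4# ⟩
        ι (2 ℕ.+ n) * 4# ∎)
        where
        first : ∀ n → k ℕ.+ suc (suc n) ℕ.≤ N → ι n * κ k n ≈ ι n * 4#
        -- `κ-value 0` is 2 rather than 4; the factor `ι 0` absorbs the discrepancy.
        first zero    l = trans (zeroˡ _) (sym (zeroˡ _))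
        first (suc n) l = *-congˡ (κ≈ (suc n) k (lower {k} (shift k (suc n) (lower {k} (shift k (2 ℕ.+ n) l)))))

    coeff₂ : 1 ℕ.≤ N → coeff 2 0 N ≈ 1# + 1#
    coeff₂ 1≤N = *-cancelˡ-≈ 0<2 (trans (sym (L-* M (1# + 1#) _)) (trans (κ≈ N 0 ℕ.≤-refl) (value N 1≤N)))
      where
      value : ∀ N → 1 ℕ.≤ N → κ-value N ≈ 4#
      value (suc N) _ = refl

  -- Multiplication by q⁻¹, and the passage from b to b + 2.

  coeff-rec : ∀ b i n → coeff b i (suc n) ≈ coeff b i n + (coeff b (suc i) (suc n) + coeff b (suc i) n)
  coeff-rec b i n = begin
    y
      ≈⟨ solve 3 (λ y x x′ → y := x :+ ((y :- x :- x′) :+ x′)) refl y x x′ ⟩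
    x + ((y - x - x′) + x′)
      -- `y - x - x′` is `L M` of the defining clause of `w`, the coefficient form of (1 - t) qⁱ =
      -- (1 + t) qⁱ⁺¹.
      ≈⟨ +-cong (coeff-L b i n<M) (+-cong (sym (trans (L-- M _ _) (+-congʳ (L-- M _ _)))) (coeff-L b (suc i) n<M)) ⟩
    coeff b i n + (coeff b (suc i) (suc n) + coeff b (suc i) n) ∎
    where
    M  = suc (dbl (suc n))
    n<M = ℕ.m≤n+m (suc (dbl n)) 2
    x  = L M (λ z → w n (i ℕ.+ e b z))
    x′ = L M (λ z → w n (suc i ℕ.+ e b z))
    y  = coeff b i (suc n)

  -- Since (x + 1)² + b (x + 1) = (b + 1) + x² + (b + 2) x, the shifted summand belongs to b + 2
  -- times qᵇ⁺¹, and `L-symm` applies. The resulting constant 2 has no coefficients of positive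
  -- index.
  coeff-reflect : ∀ b n → coeff b 0 (suc n) + coeff (2 ℕ.+ b) (suc b) (suc n) ≈ 0#
  coeff-reflect b n = begin
    coeff b 0 (suc n) + coeff (2 ℕ.+ b) (suc b) (suc n)
      ≈⟨ +-congˡ (L-cong M (λ x → reflexive (≡.cong (w (suc n)) (≡.sym (eq b x))))) ⟩
    L M v + L M (v ∘ suc)
      ≈⟨ L-+ M v (v ∘ suc) ⟨
    L M (λ x → v x + v (suc x))
      ≈⟨ L-symm M v (Deg<-w b 0 (suc n)) ⟩
    (1# + 1#) * w (suc n) (b ℕ.* 0)
      ≈⟨ *-congˡ (reflexive (≡.cong (w (suc n)) (ℕ.*-zeroʳ b))) ⟩
    (1# + 1#) * 0#
      ≈⟨ zeroʳ _ ⟩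
    0# ∎
    where
    M = suc (dbl (suc n))

    v : ℕ → Carrier
    v x = w (suc n) (e b x)

    eq : ∀ b x → suc x ℕ.* suc x ℕ.+ b ℕ.* suc x ≡ suc b ℕ.+ (x ℕ.* x ℕ.+ (2 ℕ.+ b) ℕ.* x)
    eq = solve-∀

  -- The bound 1 is stable where positivity is not: partial sums of merely positive terms could stay
  -- negative.
  Eventually≥1 : (ℕ → Carrier) → Set _
  Eventually≥1 a = ∃[ N ] (∀ n → N ℕ.≤ n → 1# ≤ a n)

  -- From N on, d grows by at least 1 per step, so it passes 1 whatever the value d N.
  eventually-sum : ∀ {a d : ℕ → Carrier} → (∀ n → d (suc n) ≈ d n + (a (suc n) + a n)) →
    Eventually≥1 a → Eventually≥1 d
  eventually-sum {a} {d} rec (N , p) = m ℕ.+ N , λ n l →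
      ≡.subst (λ k → 1# ≤ d k) (ℕ.m∸n+n≡m (ℕ.≤-trans (ℕ.m≤n+m N m) l))
        (≤-trans (0≤⇒≤ (≤-resp refl
            (solve 2 (λ k d → k :- (:1 :- d) := (k :+ d) :- :1) refl (ι (n ℕ.∸ N)) (d N))
            (≤⇒0≤ (≤-trans (<⇒≤ (proj₂ (archimedean (1# - d N)))) (ι-mono (m≤ n l))))))
          (grow (n ℕ.∸ N)))
    where
    m = proj₁ (archimedean (1# - d N))

    m≤ : ∀ n → m ℕ.+ N ℕ.≤ n → m ℕ.≤ n ℕ.∸ N
    m≤ n l = ≡.subst (ℕ._≤ n ℕ.∸ N) (ℕ.m+n∸n≡m m N) (ℕ.∸-monoˡ-≤ N l)

    grow : ∀ k → ι k + d N ≤ d (k ℕ.+ N)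
    grow zero    = ≤-reflexive (+-identityˡ _)
    grow (suc k) = ≤-resp (solve 2 (λ k d → (k :+ d) :+ (:1 :+ :0) := :1 :+ k :+ d) refl (ι k) (d N))
      (sym (rec (k ℕ.+ N)))
      (+-mono-≤ (grow k) (+-mono-≤ (p (suc k ℕ.+ N) (ℕ.m≤n+m N (suc k)))
        (≤-trans 0≤1 (p (k ℕ.+ N) (ℕ.m≤n+m N k)))))

  -- Used with s = 1 and s = - 1 to treat both signs at once; i is the power of q in front of the
  -- series.
  Signed : Carrier → ℕ → ℕ → Set _
  Signed s b i = Eventually≥1 (λ n → s * coeff b i n)

  Signed-pred : ∀ {s} b i → Signed s b (suc i) → Signed s b i
  Signed-pred {s} b i = eventually-sum (λ n → trans (*-congˡ (coeff-rec b i n))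
    (solve 4 (λ s x y z → s :* (x :+ (y :+ z)) := s :* x :+ (s :* y :+ s :* z)) refl
      s (coeff b i n) (coeff b (suc i) (suc n)) (coeff b (suc i) n)))

  Signed-zero : ∀ {s} b i → Signed s b i → Signed s b 0
  Signed-zero b zero    p = p
  Signed-zero b (suc i) p = Signed-zero b i (Signed-pred b i p)

  Signed-reflect : ∀ {s} b → Signed s b 0 → Signed (- s) (2 ℕ.+ b) (suc b)
  -- Index 0 has to be excluded, as the two constant terms add up to 2.
  Signed-reflect {s} b (N , p) = suc N , reflected
    where
    reflected : ∀ n → suc N ℕ.≤ n → 1# ≤ - s * coeff (2 ℕ.+ b) (suc b) n
    reflected (suc n) l = ≤-resp refl
      (trans (solve 3 (λ s x y → s :* x := s :* (x :+ y) :+ :- s :* y) refl s (coeff b 0 (suc n)) y)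
        (trans (+-congʳ (trans (*-congˡ (coeff-reflect b n)) (zeroʳ s))) (+-identityˡ _)))
      (p (suc n) (ℕ.≤-trans (ℕ.n≤1+n N) l))
      where
      y = coeff (2 ℕ.+ b) (suc b) (suc n)

  Signed-+2 : ∀ {s} b → Signed s b 0 → Signed (- s) (2 ℕ.+ b) 0
  Signed-+2 b p = Signed-zero (2 ℕ.+ b) (suc b) (Signed-reflect b p)

  Signed-+4 : ∀ {s} b → Signed s b 0 → Signed s (4 ℕ.+ b) 0
  Signed-+4 {s} b p =
    let N , p′ = Signed-+2 (2 ℕ.+ b) (Signed-+2 b p) in
    N , λ n l → ≤-resp refl (*-congʳ (-‿involutive s)) (p′ n l)

  Signed-1 : Signed 1# 1 0
  Signed-1 = 0 , λ n _ → ≤-resp refl (sym (*-identityˡ _)) (coeff₁-≥1 n)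

  Signed-2 : Signed 1# 2 0
  Signed-2 = 1 , λ n l → ≤-resp (+-identityʳ 1#) (sym (trans (*-identityˡ _) (coeff₂ n l))) (+-monoʳ-≤ 1# 0≤1)

  signs : ∀ b → (suc b % 4 ≡ 1 ⊎ suc b % 4 ≡ 2 → Signed 1# (suc b) 0) ×
                (suc b % 4 ≡ 0 ⊎ suc b % 4 ≡ 3 → Signed (- 1#) (suc b) 0)
  signs 0 = (λ _ → Signed-1) , λ { (inj₁ ()) ; (inj₂ ()) }
  signs 1 = (λ _ → Signed-2) , λ { (inj₁ ()) ; (inj₂ ()) }
  signs 2 = (λ { (inj₁ ()) ; (inj₂ ()) }) , λ _ → Signed-+2 1 Signed-1
  signs 3 = (λ { (inj₁ ()) ; (inj₂ ()) }) , λ _ → Signed-+2 2 Signed-2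
  -- The residue of 5 + b modulo 4 computes to that of `suc b`, so r is passed on unchanged.
  signs (suc (suc (suc (suc b)))) =
    (λ r → Signed-+4 (suc b) (proj₁ (signs b) r)) , (λ r → Signed-+4 (suc b) (proj₂ (signs b) r))

-- Conclusion for an arbitrary expansion.

residues : ∀ r → r ℕ.< 4 → (r ≡ 1 ⊎ r ≡ 2) ⊎ (r ≡ 0 ⊎ r ≡ 3)
residues 0 _ = inj₂ (inj₁ ≡.refl)
residues 1 _ = inj₁ (inj₁ ≡.refl)
residues 2 _ = inj₁ (inj₂ ≡.refl)
residues 3 _ = inj₂ (inj₂ ≡.refl)
residues (suc (suc (suc (suc _)))) (ℕ.s≤s (ℕ.s≤s (ℕ.s≤s (ℕ.s≤s ()))))

theorem1p1 : ∀ {c ℓ₁ ℓ₂} (ℝ : RealField c ℓ₁ ℓ₂) → let open Real ℝ in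
    (b : ℕ) → NonZero b → (a : ℕ → RealField.Carrier ℝ) → f b ∼ a →
    (b % 4 ≡ 1 ⊎ b % 4 ≡ 2 → EventuallyPositive a) ×
    (b % 4 ≡ 0 ⊎ b % 4 ≡ 3 → EventuallyNegative a) ×
    (EventuallyPositive a ⊎ EventuallyNegative a)
theorem1p1 ℝ (suc b) _ a f∼a = positive , negative , either (residues (suc b % 4) (m%n<n (suc b) 4))
  where
  open Ordered ℝ
  open Asymptotics ℝ
  open Taylor ℝ
  open Signs ℝ

  -- By uniqueness the given expansion is the one computed by Euler's transformation, so the signs
  -- carry over.
  a≈ : ∀ n → coeff (suc b) 0 n ≈ a n
  a≈ = ∼-unique (f∼coeff b) f∼a

  positive : suc b % 4 ≡ 1 ⊎ suc b % 4 ≡ 2 → EventuallyPositive a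
  positive r =
    let N , p = proj₁ (signs b) r in
    N , λ n l → <-≤-trans 0<1 (≤-resp refl (trans (*-identityˡ _) (a≈ n)) (p n l))

  negative : suc b % 4 ≡ 0 ⊎ suc b % 4 ≡ 3 → EventuallyNegative a
  negative r =
    let N , p = proj₂ (signs b) r in
    N , λ n l → <-resp
      (trans (solve 1 (λ x → :- (:- :1 :* x) := x) refl (coeff (suc b) 0 n)) (a≈ n)) -0#≈0#
      (neg-anti-< (<-≤-trans 0<1 (p n l)))

  either : (suc b % 4 ≡ 1 ⊎ suc b % 4 ≡ 2) ⊎ (suc b % 4 ≡ 0 ⊎ suc b % 4 ≡ 3) →
    EventuallyPositive a ⊎ EventuallyNegative a
  either (inj₁ r) = inj₁ (positive r)
  either (inj₂ r) = inj₂ (negative r)
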